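{- For a positive integer $n$, let $\mathcal{P}_n = \{(i,j)\in\mathbb{Z}^2 \mid 1\le i,j\le \sqrt{n}\}$ be the vertex set of the $\sqrt{n}\times\sqrt{n}$ integer lattice, and let $$Q_n = \left\{(a,p,b,q)\in \mathcal{P}_n^4 \mid |ap|=|bq|>0\right\}.$$ Then $|Q_n| = \Theta(n^3\log n)$ as $n\to\infty$; that is, there exist constants $c,C>0$ and $n_0$ such that $c\,n^3\log n\le |Q_n|\le C\,n^3\log n$ for all $n\ge n_0$.
   Context: Here $|ap|$ denotes the Euclidean distance between the points $a$ and $p$ in the plane. The quadruples in $Q_n$ are ordered (different orderings of the same points are counted as distinct elements), and the segments $ap$ and $bq$ are allowed to share endpoints or coincide. -}

module Defs where

open import Data.Integer as ℤ using (ℤ; +_; -[1+_]; 0ℤ; 1ℤ)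
import Data.Integer.Properties as ℤ
open import Data.List using (List; map; filter; foldr; length; upTo; cartesianProduct)
open import Data.List.Membership.Propositional using (_∈_)
open import Data.List.Membership.Propositional.Properties
  using (∈-map⁺; ∈-upTo⁺; ∈-filter⁺; ∈-filter⁻; ∈-cartesianProduct⁺; ∈-cartesianProduct⁻)
open import Data.List.Relation.Unary.Unique.Propositional using (Unique)
import Data.List.Relation.Unary.Unique.Propositional.Properties as Unique
open import Data.Nat as ℕ using (ℕ; suc)
import Data.Nat.Properties as ℕ
open import Data.Product using (_×_; _,_; proj₂)
open import Data.Rational.Unnormalised as ℚᵘ using (ℚᵘ; 0ℚᵘ)
open import Function using (_∘_; _⇔_; mk⇔)
open import Relation.Binary.PropositionalEquality using (_≡_)
open import Relation.Nullary using (Dec)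
open import Relation.Nullary.Decidable using (_×-dec_)

Point : Set
Point = ℤ × ℤ

-- 1 ≤ i ≤ √n: for i ≥ 1, the bound i ≤ √n means i² ≤ n.
-- n need not be a perfect square.
InRange : ℕ → ℤ → Set
InRange n i = 1ℤ ℤ.≤ i × i ℤ.* i ℤ.≤ + n

InRange? : ∀ n i → Dec (InRange n i)
InRange? n i = (1ℤ ℤ.≤? i) ×-dec (i ℤ.* i ℤ.≤? + n)

In𝒫 : ℕ → Point → Set
In𝒫 n (i , j) = InRange n i × InRange n j

-- The square of the Euclidean distance.
dist² : Point → Point → ℤ
dist² (x , y) (x′ , y′) =
  (x ℤ.- x′) ℤ.* (x ℤ.- x′) ℤ.+ (y ℤ.- y′) ℤ.* (y ℤ.- y′)

Quadruple : Set
Quadruple = Point × Point × Point × Point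

-- |ap| = |bq| > 0, with both distances squared.
EqualPositive : Quadruple → Set
EqualPositive (a , p , b , q) = dist² a p ≡ dist² b q × 0ℤ ℤ.< dist² b q

EqualPositive? : ∀ t → Dec (EqualPositive t)
EqualPositive? (a , p , b , q) =
  (dist² a p ℤ.≟ dist² b q) ×-dec (0ℤ ℤ.<? dist² b q)

InQ : ℕ → Quadruple → Set
InQ n t@(a , p , b , q) =
  (In𝒫 n a × In𝒫 n p × In𝒫 n b × In𝒫 n q) × EqualPositive t

-- Searching 1, …, n suffices, since i ≤ i² ≤ n.
coords : ℕ → List ℤ
coords n = filter (InRange? n) (map (+_ ∘ suc) (upTo n))

𝒫 : ℕ → List Point
𝒫 n = cartesianProduct (coords n) (coords n)

𝒫⁴ : ℕ → List Quadruple
𝒫⁴ n = cartesianProduct (𝒫 n) (cartesianProduct (𝒫 n) (cartesianProduct (𝒫 n) (𝒫 n)))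

Q : ℕ → List Quadruple
Q n = filter EqualPositive? (𝒫⁴ n)

∣Q∣ : ℕ → ℕ
∣Q∣ n = length (Q n)

-- Q n lists the quadruples satisfying InQ n, each exactly once,
-- so its length is the cardinality of the set (Q-unique, ∈-Q).

coords-unique : ∀ n → Unique (coords n)
coords-unique n =
  Unique.filter⁺ (InRange? n) (Unique.map⁺ (ℕ.suc-injective ∘ ℤ.+-injective) (Unique.upTo⁺ n))

∈-coords : ∀ n i → i ∈ coords n ⇔ InRange n i
∈-coords n i = mk⇔
  (proj₂ ∘ ∈-filter⁻ (InRange? n) {xs = map (+_ ∘ suc) (upTo n)}) (from i)
  where
  from : ∀ i → InRange n i → i ∈ coords n
  from (+ 0)      (ℤ.+≤+ () , _)
  from -[1+ _ ]   (() , _)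
  from (+ suc k) r@(_ , ℤ.+≤+ k²≤n) =
    ∈-filter⁺ (InRange? n)
      (∈-map⁺ (+_ ∘ suc) (∈-upTo⁺ (ℕ.≤-trans (ℕ.m≤m*n (suc k) (suc k)) k²≤n))) r

𝒫-unique : ∀ n → Unique (𝒫 n)
𝒫-unique n = Unique.cartesianProduct⁺ (coords-unique n) (coords-unique n)

∈-𝒫 : ∀ n a → a ∈ 𝒫 n ⇔ In𝒫 n a
∈-𝒫 n (i , j) = mk⇔ to from
  where
  module I = Function.Equivalence (∈-coords n i)
  module J = Function.Equivalence (∈-coords n j)
  to : (i , j) ∈ 𝒫 n → In𝒫 n (i , j)
  to m with i∈ , j∈ ← ∈-cartesianProduct⁻ (coords n) (coords n) m = I.to i∈ , J.to j∈
  from : In𝒫 n (i , j) → (i , j) ∈ 𝒫 n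
  from (ri , rj) = ∈-cartesianProduct⁺ (I.from ri) (J.from rj)

Q-unique : ∀ n → Unique (Q n)
Q-unique n = Unique.filter⁺ EqualPositive?
  (Unique.cartesianProduct⁺ u (Unique.cartesianProduct⁺ u (Unique.cartesianProduct⁺ u u)))
  where u = 𝒫-unique n

∈-Q : ∀ n t → t ∈ Q n ⇔ InQ n t
∈-Q n t@(a , p , b , q) = mk⇔ to from
  where
  module P x = Function.Equivalence (∈-𝒫 n x)
  𝒫² : List (Point × Point)
  𝒫² = cartesianProduct (𝒫 n) (𝒫 n)
  to : t ∈ Q n → InQ n t
  to m with m₄ , e ← ∈-filter⁻ EqualPositive? {xs = 𝒫⁴ n} m
       with a∈ , m₃ ← ∈-cartesianProduct⁻ (𝒫 n) (cartesianProduct (𝒫 n) 𝒫²) m₄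
       with p∈ , m₂ ← ∈-cartesianProduct⁻ (𝒫 n) 𝒫² m₃
       with b∈ , q∈ ← ∈-cartesianProduct⁻ (𝒫 n) (𝒫 n) m₂
     = (P.to a a∈ , P.to p p∈ , P.to b b∈ , P.to q q∈) , e
  from : InQ n t → t ∈ Q n
  from ((ra , rp , rb , rq) , e) = ∈-filter⁺ EqualPositive?
    (∈-cartesianProduct⁺ (P.from a ra)
      (∈-cartesianProduct⁺ (P.from p rp)
        (∈-cartesianProduct⁺ (P.from b rb) (P.from q rq)))) e

fromℕ : ℕ → ℚᵘ
fromℕ m = + m ℚᵘ./ 1

sumℚᵘ : List ℚᵘ → ℚᵘ
sumℚᵘ = foldr ℚᵘ._+_ 0ℚᵘ

-- The natural logarithm, log n = ∫₁ⁿ dt/t for n ≥ 1, enters through its Darboux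
-- sums. Cut [1, n] into (n ∸ 1) K intervals [(K + i)/K, (K + i + 1)/K] of
-- length 1/K, where K = suc k. As 1/t is decreasing, the i-th interval
-- contributes 1/(K + i + 1) to the lower sum and 1/(K + i) to the upper sum.
-- The two sums differ by (1 - 1/n)/K, so log n is the supremum over k of the
-- lower sums and the infimum over k of the upper sums.

lowerSum : (n k : ℕ) → ℚᵘ
lowerSum n k = sumℚᵘ (map (λ i → 1ℤ ℚᵘ./ (suc k ℕ.+ suc i)) (upTo ((n ℕ.∸ 1) ℕ.* suc k)))

upperSum : (n k : ℕ) → ℚᵘ
upperSum n k = sumℚᵘ (map (λ i → 1ℤ ℚᵘ./ (suc k ℕ.+ i)) (upTo ((n ℕ.∸ 1) ℕ.* suc k)))

infix 4 _·log_≤_ _≤_·log_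

-- The exact real inequalities r log n ≤ x and x ≤ r log n, for n ≥ 1 and
-- rational x and r with r ≥ 0. (For r < 0 they do not have this meaning.)

_·log_≤_ : ℚᵘ → ℕ → ℚᵘ → Set
r ·log n ≤ x = ∀ k → r ℚᵘ.* lowerSum n k ℚᵘ.≤ x

_≤_·log_ : ℚᵘ → ℚᵘ → ℕ → Set
x ≤ r ·log n = ∀ k → x ℚᵘ.≤ r ℚᵘ.* upperSum n k

{-# OPTIONS --safe #-}

-- With a - p = (x , y) and b - q = (z , w), the equation x² + y² = z² + w² reads
-- (x - z) (x + z) = (w - y) (w + y). So, besides the n² choices of p and q, one counts the
-- solutions of s t = u v of size at most N, where N is of the order of √n; they have the
-- form s = g α, u = g β, v = h α, t = h β.
--
-- Upper bound: a pair (α , β) with maximum μ leaves at most (1 + N/μ)² pairs (g , h), and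
-- there are O(μ) such (α , β), which gives O(N Σ_{μ ≤ N} ⌊N/μ⌋) solutions.
--
-- Lower bound: (g , h , α , β) can be recovered from the solution if α and β are coprime. At
-- least a quarter of the pairs in [1, M]² are coprime, because Σ_{d ≥ 2} 1/d² ≤ 3/4, so the
-- pairs (g , h) with maximum k give at least k ⌊N/k⌋²/4 solutions.
--
-- Cutting at the powers of 2 shows that Σ_{k ≤ N} ⌊N/k⌋ is of the order of N l for
-- 2^l ≤ N < 2^(l+1), and compares the Darboux sums of log n with l.

module Submission where

open import Defs
open import Data.Empty using (⊥-elim)
open import Data.Integer as ℤ using (ℤ; +_; -[1+_]; 0ℤ; 1ℤ)
import Data.Integer.Properties as ℤ
import Data.Integer.Tactic.RingSolver as ℤ-Ring
open import Data.List using (List; []; _∷_; _++_; map; length; concat; applyUpTo; upTo; cartesianProduct; filter)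
open import Data.List.Membership.Propositional using (_∈_)
open import Data.List.Membership.Propositional.Properties
open import Data.List.Properties
open import Data.List.Relation.Unary.All as All using ()
import Data.List.Relation.Unary.All.Properties as All
open import Data.List.Relation.Unary.AllPairs using (_∷_)
import Data.List.Relation.Unary.AllPairs.Properties as AllPairs
open import Data.List.Relation.Unary.Any using (here; there)
open import Data.List.Relation.Unary.Unique.Propositional using (Unique)
import Data.List.Relation.Unary.Unique.Propositional.Properties as Unique
open import Data.Nat using (ℕ; zero; suc; NonZero; ≢-nonZero; _+_; _∸_; _^_; _≤_; _≤?_; z≤n; s≤s)
open import Data.Nat.Coprimality
  using (Coprime; coprime?; coprime-/gcd; coprime-divisor; coprime⇒gcd≡1; gcd≡1⇒coprime; 0-coprimeTo-m⇒m≡1)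
open import Data.Nat.Divisibility using (_∣_; divides; ∣⇒≤)
open import Data.Nat.DivMod hiding (_/_; _%_)
open import Data.Nat.GCD
  using (gcd; gcd[m,n]∣m; gcd[m,n]∣n; gcd[m,n]≡0⇒m≡0; gcd[m,n]≡0⇒n≡0; c*gcd[m,n]≡gcd[cm,cn])
open import Data.Nat.ListAction using (sum)
open import Data.Nat.Properties
open import Data.Nat.Tactic.RingSolver using (solve-∀)
open import Data.Product using (_×_; _,_; proj₁; proj₂; ∃-syntax)
open import Data.Rational.Unnormalised as ℚᵘ using (ℚᵘ; mkℚᵘ; 0ℚᵘ; *≤*; *≡*; *<*; _≃_)
import Data.Rational.Unnormalised.Properties as ℚᵘ
open import Data.Sign as Sign using (Sign)
open import Data.Sum using (inj₁; inj₂)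
open import Function using (_∘_; Equivalence)
open import Relation.Binary.PropositionalEquality
open import Relation.Nullary using (¬_; contradiction; yes; no)
open import Relation.Nullary.Decidable using (¬?)
open import Relation.Unary using (Decidable)

-- Within this module _*_ and _<_ are those of ℕ, in the theorem those of ℚᵘ.
module _ where

  open import Data.Nat using (_*_; _<_; _/_; _%_)

  -- Lengths of lists

  private variable
    A B : Set

  -- Pigeonhole by induction on `xs`: one occurrence of the partner `y` of `x` is cut out of `ys`. A
  -- later element whose partner falls on that occurrence would equal `x` by injectivity, against
  -- uniqueness. Hence `ys` may contain repetitions.
  length-≤-relation : {xs : List A} {ys : List B} (R : A → B → Set) → Unique xs →
    (∀ {x} → x ∈ xs → ∃[ y ] y ∈ ys × R x y) →
    (∀ {x x′ y} → x ∈ xs → x′ ∈ xs → R x y → R x′ y → x ≡ x′) →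
    length xs ≤ length ys
  length-≤-relation {xs = []} R _ _ _ = z≤n
  length-≤-relation {xs = x ∷ xs} {ys} R (x∉xs ∷ u) total inj
    with y , y∈ys , Rxy ← total (here refl)
    with as , bs , refl ← ∈-∃++ y∈ys = begin
      suc (length xs)             ≤⟨ s≤s (length-≤-relation R u total′ (λ p q → inj (there p) (there q))) ⟩
      suc (length (as ++ bs))     ≡⟨ cong suc (length-++ as) ⟩
      suc (length as + length bs) ≡⟨ +-suc (length as) (length bs) ⟨
      length as + suc (length bs) ≡⟨ length-++ as ⟨
      length (as ++ y ∷ bs)       ∎
    where
    open ≤-Reasoning
    total′ : ∀ {x′} → x′ ∈ xs → ∃[ y′ ] y′ ∈ as ++ bs × R x′ y′
    total′ x′∈ with y′ , y′∈ , Rx′y′ ← total (there x′∈) with ∈-++⁻ as y′∈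
    ... | inj₁ m = y′ , ∈-++⁺ˡ m , Rx′y′
    ... | inj₂ (there m) = y′ , ∈-++⁺ʳ as m , Rx′y′
    ... | inj₂ (here refl) =
      contradiction (inj (here refl) (there x′∈) Rxy Rx′y′) (All.lookup x∉xs x′∈)

  length-filter-¬ : {P : A → Set} (P? : Decidable P) (xs : List A) →
    length xs ≡ length (filter P? xs) + length (filter (¬? ∘ P?) xs)
  length-filter-¬ P? [] = refl
  length-filter-¬ P? (x ∷ xs) with P? x
  ... | yes _ = cong suc (length-filter-¬ P? xs)
  ... | no _ = trans (cong suc (length-filter-¬ P? xs)) (sym (+-suc _ _))

  length-× : (xs : List A) (ys : List B) →
    length (cartesianProduct xs ys) ≡ length xs * length ys
  length-× [] ys = refl
  length-× (x ∷ xs) ys = trans (length-++ (map (x ,_) ys))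
    (cong₂ _+_ (length-map (x ,_) ys) (length-× xs ys))

  -- Finite sums of natural numbers

  ∑ : ℕ → (ℕ → ℕ) → ℕ
  ∑ n f = sum (applyUpTo f n)

  ∑-mono : ∀ n {f g} → (∀ i → i < n → f i ≤ g i) → ∑ n f ≤ ∑ n g
  ∑-mono zero h = z≤n
  ∑-mono (suc n) h = +-mono-≤ (h 0 (s≤s z≤n)) (∑-mono n (λ i i<n → h (suc i) (s≤s i<n)))

  ∑-cong : ∀ n {f g} → (∀ i → f i ≡ g i) → ∑ n f ≡ ∑ n g
  ∑-cong zero h = refl
  ∑-cong (suc n) h = cong₂ _+_ (h 0) (∑-cong n (h ∘ suc))

  ∑-const : ∀ n c → ∑ n (λ _ → c) ≡ n * c
  ∑-const zero c = refl
  ∑-const (suc n) c = cong (λ x → c + x) (∑-const n c)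

  ∑-*ˡ : ∀ n c f → ∑ n (λ i → c * f i) ≡ c * ∑ n f
  ∑-*ˡ zero c f = sym (*-zeroʳ c)
  ∑-*ˡ (suc n) c f = trans (cong (λ x → c * f 0 + x) (∑-*ˡ n c (f ∘ suc))) (sym (*-distribˡ-+ c (f 0) _))

  ∑-+ : ∀ a b f → ∑ (a + b) f ≡ ∑ a f + ∑ b (λ i → f (a + i))
  ∑-+ zero b f = refl
  ∑-+ (suc a) b f = trans (cong (λ x → f 0 + x) (∑-+ a b (f ∘ suc))) (sym (+-assoc (f 0) _ _))

  ∑-extend : ∀ {a b} f → a ≤ b → ∑ a f ≤ ∑ b f
  ∑-extend {a} {b} f a≤b = begin
    ∑ a f                                  ≤⟨ m≤m+n _ _ ⟩
    ∑ a f + ∑ (b ∸ a) (λ i → f (a + i))    ≡⟨ ∑-+ a (b ∸ a) f ⟨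
    ∑ (a + (b ∸ a)) f                      ≡⟨ cong (λ x → ∑ x f) (m+[n∸m]≡n a≤b) ⟩
    ∑ b f                                  ∎
    where open ≤-Reasoning

  ∑-suc : ∀ n f → ∑ (suc n) f ≡ ∑ n f + f n
  ∑-suc n f = begin
    ∑ (suc n) f          ≡⟨ cong (λ x → ∑ x f) (+-comm 1 n) ⟩
    ∑ (n + 1) f          ≡⟨ ∑-+ n 1 f ⟩
    ∑ n f + (f (n + 0) + 0) ≡⟨ cong (λ x → ∑ n f + x) (trans (+-identityʳ _) (cong f (+-identityʳ n))) ⟩
    ∑ n f + f n          ∎
    where open ≡-Reasoning

  -- Indexed disjoint unions of lists

  ⨆ : (n : ℕ) → (ℕ → List A) → List (ℕ × A)
  ⨆ n g = concat (applyUpTo (λ i → map (i ,_) (g i)) n)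

  length-⨆ : ∀ n (g : ℕ → List A) → length (⨆ n g) ≡ ∑ n (length ∘ g)
  length-⨆ n g = length-concat n (λ i → length-map (i ,_) (g i))
    where
    length-concat : ∀ {C : Set} n {f : ℕ → List C} {h} → (∀ i → length (f i) ≡ h i) →
      length (concat (applyUpTo f n)) ≡ ∑ n h
    length-concat zero e = refl
    length-concat (suc n) {f} e =
      trans (length-++ (f 0)) (cong₂ _+_ (e 0) (length-concat n (e ∘ suc)))

  ∈-⨆⁺ : ∀ {n} (g : ℕ → List A) {i x} → i < n → x ∈ g i → (i , x) ∈ ⨆ n g
  ∈-⨆⁺ g {i} i<n x∈ = ∈-concat⁺′ (∈-map⁺ (i ,_) x∈) (∈-applyUpTo⁺ (λ i → map (i ,_) (g i)) i<n)

  ∈-⨆⁻ : ∀ {n} (g : ℕ → List A) {i x} → (i , x) ∈ ⨆ n g → i < n × x ∈ g i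
  ∈-⨆⁻ {n = n} g m
    with _ , m₁ , m₂ ← ∈-concat⁻′ (applyUpTo (λ i → map (i ,_) (g i)) n) m
    with j , j<n , refl ← ∈-applyUpTo⁻ (λ i → map (i ,_) (g i)) m₂
    with _ , x∈ , refl ← ∈-map⁻ (j ,_) m₁ = j<n , x∈

  ⨆-unique : ∀ n (g : ℕ → List A) → (∀ i → Unique (g i)) → Unique (⨆ n g)
  ⨆-unique n g u = Unique.concat⁺
    (All.applyUpTo⁺₂ _ n (λ i → Unique.map⁺ (cong proj₂) (u i)))
    (AllPairs.applyUpTo⁺₁ _ n (λ {i} {j} i<j _ (p , q) → disjoint i<j p q))
    where
    disjoint : ∀ {i j v} → i < j → v ∈ map (i ,_) (g i) → v ∈ map (j ,_) (g j) → _
    disjoint {i} {j} i<j p q with _ , _ , refl ← ∈-map⁻ (i ,_) p with _ , _ , refl ← ∈-map⁻ (j ,_) q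
      = <-irrefl refl i<j

  -- Dyadic bounds for Σ ⌊N/k⌋

  -- The remainder is below `n`, and `n` is at most `n * (m / n)` because the quotient is at least
  -- 1.
  half-≤-/ : ∀ {m n} .{{_ : NonZero n}} → n ≤ m → m ≤ 2 * (n * (m / n))
  half-≤-/ {m} {n} n≤m = begin
    m                           ≡⟨ m≡m%n+[m/n]*n m n ⟩
    m % n + m / n * n           ≤⟨ +-monoˡ-≤ _ (<⇒≤ (m%n<n m n)) ⟩
    n + m / n * n               ≡⟨ cong₂ _+_ (sym (*-identityʳ n)) (*-comm (m / n) n) ⟩
    n * 1 + n * (m / n)         ≤⟨ +-monoˡ-≤ _ (*-monoʳ-≤ n (m≥n⇒m/n>0 n≤m)) ⟩
    n * (m / n) + n * (m / n)   ≡⟨ cong (λ x → n * (m / n) + x) (sym (+-identityʳ _)) ⟩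
    2 * (n * (m / n))           ∎
    where open ≤-Reasoning

  n*[m/n]≤m : ∀ m n .{{_ : NonZero n}} → n * (m / n) ≤ m
  n*[m/n]≤m m n = subst (_≤ m) (*-comm (m / n) n) (m/n*n≤m m n)

  *≤⇒≤/ : ∀ {k m n} .{{_ : NonZero n}} → k * n ≤ m → k ≤ m / n
  *≤⇒≤/ {k} {m} {n} p = subst (_≤ m / n) (m*n/n≡m k n) (/-monoˡ-≤ n p)

  -- For `r = N` this is the summatory function of the number of divisors.
  ∑⌊_/_⌋ : ℕ → ℕ → ℕ
  ∑⌊ N / r ⌋ = ∑ r (λ i → N / suc i)

  1+[2^l∸1]≡2^l : ∀ l → suc (2 ^ l ∸ 1) ≡ 2 ^ l
  1+[2^l∸1]≡2^l l = m+[n∸m]≡n (m^n>0 2 l)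

  2^[1+l]∸1≡ : ∀ l → 2 ^ suc l ∸ 1 ≡ (2 ^ l ∸ 1) + 2 ^ l
  2^[1+l]∸1≡ l = trans (cong (λ x → x + (x + 0) ∸ 1) (sym (1+[2^l∸1]≡2^l l)))
    (cong (λ x → 2 ^ l ∸ 1 + x) (trans (+-identityʳ _) (1+[2^l∸1]≡2^l l)))

  -- The block 2^l ≤ k < 2^(l+1) has 2^l terms, each at most ⌊N/2^l⌋, and so adds at most N.
  ∑⌊/⌋-upper : ∀ N l → ∑⌊ N / 2 ^ l ∸ 1 ⌋ ≤ l * N
  ∑⌊/⌋-upper N zero = z≤n
  ∑⌊/⌋-upper N (suc l) = begin
    ∑⌊ N / 2 ^ suc l ∸ 1 ⌋        ≡⟨ cong ∑⌊ N /_⌋ (2^[1+l]∸1≡ l) ⟩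
    ∑⌊ N / a + 2 ^ l ⌋            ≡⟨ ∑-+ a (2 ^ l) (λ i → N / suc i) ⟩
    ∑⌊ N / a ⌋ + ∑ (2 ^ l) (λ i → N / suc (a + i))
      ≤⟨ +-mono-≤ (∑⌊/⌋-upper N l) (∑-mono (2 ^ l) (λ i _ → /-monoʳ-≤ N (s≤s (m≤m+n a i)))) ⟩
    l * N + ∑ (2 ^ l) (λ i → N / suc a) ≡⟨ cong (λ x → l * N + x) (∑-const (2 ^ l) _) ⟩
    l * N + 2 ^ l * (N / suc a)   ≡⟨ cong (λ x → l * N + x * (N / suc a)) (sym (1+[2^l∸1]≡2^l l)) ⟩
    l * N + suc a * (N / suc a)   ≤⟨ +-monoʳ-≤ (l * N) (n*[m/n]≤m N (suc a)) ⟩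
    l * N + N                     ≡⟨ +-comm (l * N) N ⟩
    suc l * N                     ∎
    where
    open ≤-Reasoning
    a = 2 ^ l ∸ 1

  -- Each of the 2^l terms with 2^l ≤ k < 2^(l+1) is at least ⌊N/2^(l+1)⌋. As 2^(l+1) ≤ N, rounding
  -- down loses at most half, so the block adds at least N/4.
  ∑⌊/⌋-lower : ∀ N l → 2 ^ l ≤ N → l * N ≤ 4 * ∑⌊ N / 2 ^ l ∸ 1 ⌋
  ∑⌊/⌋-lower N zero _ = z≤n
  ∑⌊/⌋-lower N (suc l) 2^≤N = begin
    suc l * N                     ≡⟨ +-comm N (l * N) ⟩
    l * N + N                     ≤⟨ +-mono-≤ (∑⌊/⌋-lower N l (≤-trans (^-monoʳ-≤ 2 (n≤1+n l)) 2^≤N)) block ⟩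
    4 * ∑⌊ N / a ⌋ + 4 * ∑ (2 ^ l) (λ i → N / suc (a + i)) ≡⟨ *-distribˡ-+ 4 ∑⌊ N / a ⌋ _ ⟨
    4 * (∑⌊ N / a ⌋ + ∑ (2 ^ l) (λ i → N / suc (a + i)))   ≡⟨ cong (4 *_) (∑-+ a (2 ^ l) (λ i → N / suc i)) ⟨
    4 * ∑⌊ N / a + 2 ^ l ⌋        ≡⟨ cong (λ x → 4 * ∑⌊ N / x ⌋) (2^[1+l]∸1≡ l) ⟨
    4 * ∑⌊ N / 2 ^ suc l ∸ 1 ⌋    ∎
    where
    open ≤-Reasoning
    a = 2 ^ l ∸ 1
    instance
      2^≢0 : NonZero (2 ^ suc l)
      2^≢0 = m^n≢0 2 (suc l)
    bound : ∀ i → i < 2 ^ l → suc (a + i) ≤ 2 ^ suc l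
    bound i i< = begin
      suc (a + i) ≡⟨ cong (_+ i) (1+[2^l∸1]≡2^l l) ⟩
      2 ^ l + i   ≤⟨ +-monoʳ-≤ (2 ^ l) (<⇒≤ i<) ⟩
      2 ^ l + 2 ^ l ≡⟨ cong (λ x → 2 ^ l + x) (+-identityʳ _) ⟨
      2 ^ suc l ∎
    block : N ≤ 4 * ∑ (2 ^ l) (λ i → N / suc (a + i))
    block = begin
      N                               ≤⟨ half-≤-/ 2^≤N ⟩
      2 * (2 * 2 ^ l * (N / 2 ^ suc l)) ≡⟨ lemma (2 ^ l) (N / 2 ^ suc l) ⟩
      4 * (2 ^ l * (N / 2 ^ suc l))   ≡⟨ cong (4 *_) (∑-const (2 ^ l) _) ⟨
      4 * ∑ (2 ^ l) (λ i → N / 2 ^ suc l)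
        ≤⟨ *-monoʳ-≤ 4 (∑-mono (2 ^ l) (λ i i< → /-monoʳ-≤ N (bound i i<))) ⟩
      4 * ∑ (2 ^ l) (λ i → N / suc (a + i)) ∎
      where
      lemma : ∀ x y → 2 * (2 * x * y) ≡ 4 * (x * y)
      lemma = solve-∀

  -- Factoring the solutions of s t = u v

  -- Take g = gcd(s, u), α = s/g, β = u/g. Cancelling g leaves α t = β v, so α divides v by
  -- coprimality, and h = v/α.
  four-numbers : ∀ s t u v → s * t ≡ u * v →
    ∃[ g ] ∃[ h ] ∃[ α ] ∃[ β ] (s ≡ g * α × u ≡ g * β × v ≡ h * α × t ≡ h * β)
  four-numbers s t u v st≡uv with gcd s u ≟ 0
  -- Here s = u = 0: g = 0 accounts for both, and h = 1 lets α and β be v and t.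
  ... | yes e = 0 , 1 , v , t , gcd[m,n]≡0⇒m≡0 e , gcd[m,n]≡0⇒n≡0 s e , sym (+-identityʳ v) , sym (+-identityʳ t)
  ... | no g≢0 = split (coprime-divisor coprime (divides t (trans (sym αt≡βv) (*-comm α t))))
    where
    g = gcd s u
    instance
      _ : NonZero g
      _ = ≢-nonZero g≢0
    α = s / g
    β = u / g
    s≡gα : s ≡ g * α
    s≡gα = sym (m*[n/m]≡n (gcd[m,n]∣m s u))
    u≡gβ : u ≡ g * β
    u≡gβ = sym (m*[n/m]≡n (gcd[m,n]∣n s u))
    coprime : Coprime α β
    coprime = coprime-/gcd s u
    αt≡βv : α * t ≡ β * v
    αt≡βv = *-cancelˡ-≡ _ _ g (begin
      g * (α * t) ≡⟨ *-assoc g α t ⟨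
      g * α * t   ≡⟨ cong (_* t) s≡gα ⟨
      s * t       ≡⟨ st≡uv ⟩
      u * v       ≡⟨ cong (_* v) u≡gβ ⟩
      g * β * v   ≡⟨ *-assoc g β v ⟩
      g * (β * v) ∎)
      where open ≡-Reasoning
    split : α ∣ v → _
    split (divides h v≡hα) with α ≟ 0
    ... | no α≢0 = g , h , α , β , s≡gα , u≡gβ , v≡hα , *-cancelˡ-≡ t (h * β) α {{≢-nonZero α≢0}} (begin
      α * t       ≡⟨ αt≡βv ⟩
      β * v       ≡⟨ cong (β *_) v≡hα ⟩
      β * (h * α) ≡⟨ lemma β h α ⟩
      α * (h * β) ∎)
      where
      open ≡-Reasoning
      lemma : ∀ β h α → β * (h * α) ≡ α * (h * β)
      lemma = solve-∀
    -- If α = 0, coprimality forces β = 1. A quotient of v by 0 says nothing about h, so h is read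
    -- off from t = h β.
    ... | yes α≡0 = g , t , α , β , s≡gα , u≡gβ ,
        (begin
          v     ≡⟨ *-identityˡ v ⟨
          1 * v ≡⟨ cong (_* v) β≡1 ⟨
          β * v ≡⟨ αt≡βv ⟨
          α * t ≡⟨ *-comm α t ⟩
          t * α ∎) ,
        trans (sym (*-identityʳ t)) (cong (t *_) (sym β≡1))
      where
      open ≡-Reasoning
      β≡1 : β ≡ 1
      β≡1 = 0-coprimeTo-m⇒m≡1 (subst (λ x → Coprime x β) α≡0 coprime)

  -- Density of coprime pairs

  -- A pair (x , y) stands for (suc x , suc y).
  positivePairs : ℕ → List (ℕ × ℕ)
  positivePairs M = cartesianProduct (upTo M) (upTo M)

  length-positivePairs : ∀ M → length (positivePairs M) ≡ M * M
  length-positivePairs M = trans (length-× (upTo M) (upTo M)) (cong₂ _*_ (length-upTo M) (length-upTo M))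

  positivePairs-unique : ∀ M → Unique (positivePairs M)
  positivePairs-unique M = Unique.cartesianProduct⁺ (Unique.upTo⁺ M) (Unique.upTo⁺ M)

  CoprimePair : ℕ × ℕ → Set
  CoprimePair (x , y) = Coprime (suc x) (suc y)

  CoprimePair? : Decidable CoprimePair
  CoprimePair? (x , y) = coprime? (suc x) (suc y)

  coprimePairs : ℕ → List (ℕ × ℕ)
  coprimePairs M = filter CoprimePair? (positivePairs M)

  -- With S = Σ_{2 ≤ d ≤ R} ⌊M/d⌋², R = 2 + r and m = M², the bound S ≤ (3/4 - 1/R) m
  -- passes from R to R + 1, since 1/(R + 1)² ≤ 1/R - 1/(R + 1).
  telescope : ∀ r S e m → (3 + r) * (3 + r) * e ≤ m →
    (2 + r) * (4 * S) + 4 * m ≤ (2 + r) * (3 * m) →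
    (3 + r) * (4 * (S + e)) + 4 * m ≤ (3 + r) * (3 * m)
  telescope r S e m e-bound S-bound = *-cancelˡ-≤ (2 + r) (begin
    (2 + r) * ((3 + r) * (4 * (S + e)) + 4 * m)
      ≡⟨ lemma r S e m ⟩
    4 * ((2 + r) * (3 + r) * e) + ((3 + r) * ((2 + r) * (4 * S)) + 4 * (2 + r) * m)
      ≤⟨ +-monoˡ-≤ _ (*-monoʳ-≤ 4 (≤-trans (*-monoˡ-≤ e (*-monoˡ-≤ (3 + r) (n≤1+n (2 + r)))) e-bound)) ⟩
    4 * m + ((3 + r) * ((2 + r) * (4 * S)) + 4 * (2 + r) * m)
      ≡⟨ lemma′ r S m ⟩
    (3 + r) * ((2 + r) * (4 * S) + 4 * m)
      ≤⟨ *-monoʳ-≤ (3 + r) S-bound ⟩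
    (3 + r) * ((2 + r) * (3 * m))
      ≡⟨ lemma″ r m ⟩
    (2 + r) * ((3 + r) * (3 * m)) ∎)
    where
    open ≤-Reasoning
    lemma : ∀ r s e m → (2 + r) * ((3 + r) * (4 * (s + e)) + 4 * m) ≡
      4 * ((2 + r) * (3 + r) * e) + ((3 + r) * ((2 + r) * (4 * s)) + 4 * (2 + r) * m)
    lemma = solve-∀
    lemma′ : ∀ r s m → 4 * m + ((3 + r) * ((2 + r) * (4 * s)) + 4 * (2 + r) * m) ≡
      (3 + r) * ((2 + r) * (4 * s) + 4 * m)
    lemma′ = solve-∀
    lemma″ : ∀ r m → (3 + r) * ((2 + r) * (3 * m)) ≡ (2 + r) * ((3 + r) * (3 * m))
    lemma″ = solve-∀

  ∑⌊M/d⌋²-bound : ∀ M r → 4 * ∑ r (λ j → (M / (2 + j)) * (M / (2 + j))) ≤ 3 * (M * M)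
  ∑⌊M/d⌋²-bound M zero = z≤n
  ∑⌊M/d⌋²-bound M (suc r) =
    *-cancelˡ-≤ (2 + r) (≤-trans (m≤m+n ((2 + r) * (4 * ∑ (suc r) e)) (4 * (M * M))) (partial r))
    where
    open ≤-Reasoning
    e : ℕ → ℕ
    e j = (M / (2 + j)) * (M / (2 + j))
    e-bound : ∀ j → (2 + j) * (2 + j) * e j ≤ M * M
    e-bound j = begin
      (2 + j) * (2 + j) * e j                               ≡⟨ lemma (2 + j) (M / (2 + j)) ⟩
      (2 + j) * (M / (2 + j)) * ((2 + j) * (M / (2 + j)))   ≤⟨ *-mono-≤ (n*[m/n]≤m M (2 + j)) (n*[m/n]≤m M (2 + j)) ⟩
      M * M                                                 ∎
      where
      lemma : ∀ d q → d * d * (q * q) ≡ d * q * (d * q)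
      lemma = solve-∀
    -- The summand `4 * (M * M)` carries the term 1/R that makes the sum telescope; it is dropped
    -- only at the end. The induction starts at R = 2 with 1/4 = 3/4 - 1/2.
    partial : ∀ r → (2 + r) * (4 * ∑ (suc r) e) + 4 * (M * M) ≤ (2 + r) * (3 * (M * M))
    partial zero = begin
      2 * (4 * ∑ 1 e) + 4 * (M * M)       ≡⟨ lemma (e 0) (M * M) ⟩
      2 * (2 * 2 * e 0) + 4 * (M * M)     ≤⟨ +-monoˡ-≤ (4 * (M * M)) (*-monoʳ-≤ 2 (e-bound 0)) ⟩
      2 * (M * M) + 4 * (M * M)           ≡⟨ lemma′ (M * M) ⟩
      2 * (3 * (M * M))                   ∎
      where
      lemma : ∀ x y → 2 * (4 * (x + 0)) + 4 * y ≡ 2 * (2 * 2 * x) + 4 * y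
      lemma = solve-∀
      lemma′ : ∀ y → 2 * y + 4 * y ≡ 2 * (3 * y)
      lemma′ = solve-∀
    partial (suc r) = subst (λ x → (3 + r) * (4 * x) + 4 * (M * M) ≤ (3 + r) * (3 * (M * M)))
      (sym (∑-suc (suc r) e))
      (telescope r (∑ (suc r) e) (e (suc r)) (M * M) (e-bound (suc r)) (partial r))

  -- A pair with greatest common divisor d ≥ 2 is d times a pair from [1, M/d]². Since d divides a
  -- number up to M, the index j = d - 2 is below M.
  non-coprime-bound : ∀ M → length (filter (¬? ∘ CoprimePair?) (positivePairs M)) ≤
    ∑ M (λ j → (M / (2 + j)) * (M / (2 + j)))
  non-coprime-bound M = subst (length xs ≤_)
    (trans (length-⨆ M g) (∑-cong M (λ j → length-positivePairs (M / (2 + j)))))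
    (length-≤-relation Multiple (Unique.filter⁺ (¬? ∘ CoprimePair?) (positivePairs-unique M)) total
      (λ {p} {p′} {q} → inj {p} {p′} {q}))
    where
    xs = filter (¬? ∘ CoprimePair?) (positivePairs M)
    g : ℕ → List (ℕ × ℕ)
    g j = positivePairs (M / (2 + j))
    Multiple : ℕ × ℕ → ℕ × (ℕ × ℕ) → Set
    Multiple (x , y) (j , x′ , y′) = suc x ≡ suc x′ * (2 + j) × suc y ≡ suc y′ * (2 + j)
    inj : ∀ {p p′ q} → p ∈ xs → p′ ∈ xs → Multiple p q → Multiple p′ q → p ≡ p′
    inj _ _ (a , b) (c , d) = cong₂ _,_ (suc-injective (trans a (sym c))) (suc-injective (trans b (sym d)))
    quotient : ∀ {d x} → suc (suc d) ∣ suc x → x < M → ∃[ x′ ] x′ < M / (2 + d) × suc x ≡ suc x′ * (2 + d)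
    quotient {d} (divides (suc k) e) x<M = k , *≤⇒≤/ {suc k} {M} {2 + d} (subst (_≤ M) e x<M) , e
    total : ∀ {p} → p ∈ xs → ∃[ q ] q ∈ ⨆ M g × Multiple p q
    total {x , y} p∈
      with p∈M , ¬c ← ∈-filter⁻ (¬? ∘ CoprimePair?) {xs = positivePairs M} p∈
      with x∈ , y∈ ← ∈-cartesianProduct⁻ (upTo M) (upTo M) p∈M
      with gcd (suc x) (suc y) in eq | gcd[m,n]∣m (suc x) (suc y) | gcd[m,n]∣n (suc x) (suc y)
    ... | zero | divides q e | _ = contradiction (trans e (*-zeroʳ q)) λ ()
    ... | suc zero | _ | _ = ⊥-elim (¬c (gcd≡1⇒coprime eq))
    ... | suc (suc d) | d∣x | d∣y
      with x′ , x′< , ex ← quotient d∣x (∈-upTo⁻ x∈)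
      with y′ , y′< , ey ← quotient d∣y (∈-upTo⁻ y∈)
      = (d , x′ , y′) ,
        ∈-⨆⁺ g (≤-trans (n≤1+n (suc d)) (≤-trans (∣⇒≤ d∣x) (∈-upTo⁻ x∈)))
          (∈-cartesianProduct⁺ (∈-upTo⁺ x′<) (∈-upTo⁺ y′<)) ,
        ex , ey

  -- At most three quarters of the M² pairs fail to be coprime. Adding `3 * (M * M)` to both sides
  -- avoids truncated subtraction.
  many-coprime : ∀ M → M * M ≤ 4 * length (coprimePairs M)
  many-coprime M = +-cancelʳ-≤ (3 * (M * M)) _ _ (begin
    M * M + 3 * (M * M)           ≡⟨⟩
    4 * (M * M) ≡⟨ cong (4 *_) (trans (sym (length-positivePairs M)) (length-filter-¬ CoprimePair? (positivePairs M))) ⟩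
    4 * (C + length (filter (¬? ∘ CoprimePair?) (positivePairs M))) ≡⟨ *-distribˡ-+ 4 C _ ⟩
    4 * C + 4 * length (filter (¬? ∘ CoprimePair?) (positivePairs M))
      ≤⟨ +-monoʳ-≤ (4 * C) (≤-trans (*-monoʳ-≤ 4 (non-coprime-bound M)) (∑⌊M/d⌋²-bound M M)) ⟩
    4 * C + 3 * (M * M)           ∎)
    where
    open ≤-Reasoning
    C = length (coprimePairs M)

  -- Parameters for the lower bound

  -- An element (k , i , x , y) stands for g = suc k, h = suc i ≤ g and the coprime
  -- pair α = suc x, β = suc y, with g α ≤ N and g β ≤ N.
  factors : ℕ → List (ℕ × ℕ × ℕ × ℕ)
  factors N = ⨆ N (λ k → cartesianProduct (upTo (suc k)) (coprimePairs (N / suc k)))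

  factors-unique : ∀ N → Unique (factors N)
  factors-unique N = ⨆-unique N _ (λ k → Unique.cartesianProduct⁺ (Unique.upTo⁺ (suc k))
    (Unique.filter⁺ CoprimePair? (positivePairs-unique (N / suc k))))

  -- For g = k + 1 there are g choices of h and at least ⌊N/g⌋²/4 coprime pairs. Since g ⌊N/g⌋ ≥
  -- N/2, these are at least N ⌊N/g⌋/8 elements.
  many-factors : ∀ N → N * ∑⌊ N / N ⌋ ≤ 8 * length (factors N)
  many-factors N = begin
    N * ∑⌊ N / N ⌋                              ≡⟨ ∑-*ˡ N N _ ⟨
    ∑ N (λ k → N * (N / suc k))                 ≤⟨ ∑-mono N term ⟩
    ∑ N (λ k → 8 * length (block k))            ≡⟨ ∑-*ˡ N 8 _ ⟩
    8 * ∑ N (length ∘ block)                    ≡⟨ cong (8 *_) (length-⨆ N block) ⟨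
    8 * length (factors N)                      ∎
    where
    open ≤-Reasoning
    block : ℕ → List (ℕ × ℕ × ℕ)
    block k = cartesianProduct (upTo (suc k)) (coprimePairs (N / suc k))
    term : ∀ k → k < N → N * (N / suc k) ≤ 8 * length (block k)
    term k k<N = begin
      N * M                        ≤⟨ *-monoˡ-≤ M (half-≤-/ k<N) ⟩
      2 * (suc k * M) * M          ≡⟨ lemma (suc k) M ⟩
      2 * suc k * (M * M)          ≤⟨ *-monoʳ-≤ (2 * suc k) (many-coprime M) ⟩
      2 * suc k * (4 * C)          ≡⟨ lemma′ (suc k) C ⟩
      8 * (suc k * C)              ≡⟨ cong (λ x → 8 * (x * C)) (length-upTo (suc k)) ⟨
      8 * (length (upTo (suc k)) * C) ≡⟨ cong (8 *_) (length-× (upTo (suc k)) (coprimePairs M)) ⟨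
      8 * length (block k)         ∎
      where
      M = N / suc k
      C = length (coprimePairs M)
      lemma : ∀ k m → 2 * (k * m) * m ≡ 2 * k * (m * m)
      lemma = solve-∀
      lemma′ : ∀ k c → 2 * k * (4 * c) ≡ 8 * (k * c)
      lemma′ = solve-∀

  -- Lower bound for `∣Q∣`

  square-nonNeg : ∀ i → 0ℤ ℤ.≤ i ℤ.* i
  square-nonNeg (+ n) = subst (0ℤ ℤ.≤_) (ℤ.pos-* n n) (ℤ.+≤+ z≤n)
  square-nonNeg -[1+ n ] = ℤ.+≤+ z≤n

  -- The points P, A with A - P = (s + t , v - u), and X, B with B - X = (t - s , u + v),
  -- have coordinates which are positive combinations of s, t, u, v.
  quadruple : (p₁ p₂ q₁ q₂ s t u v : ℕ) → Quadruple
  quadruple p₁ p₂ q₁ q₂ s t u v =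
    (+ (p₁ + s + t) , + (p₂ + v)) , (+ p₁ , + (p₂ + u)) ,
    (+ (q₁ + t) , + (q₂ + u + v)) , (+ (q₁ + s) , + q₂)

  -- The squared distances differ by 4 s t - 4 u v, because (s + t)² - (t - s)² = 4 s t and (u + v)²
  -- - (v - u)² = 4 u v. The distance from b to q is positive because u + v > 0.
  quadruple-equalPositive : ∀ p₁ p₂ q₁ q₂ s t u v → s * t ≡ u * v → 0 < v →
    EqualPositive (quadruple p₁ p₂ q₁ q₂ s t u v)
  quadruple-equalPositive p₁ p₂ q₁ q₂ s t u v@(suc _) st≡uv _ =
    (begin
      dist² (+ (p₁ + s + t) , + (p₂ + v)) (+ p₁ , + (p₂ + u))
        ≡⟨ expand (+ p₁) (+ p₂) (+ q₁) (+ q₂) (+ s) (+ t) (+ u) (+ v) ⟩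
      r ℤ.+ + 4 ℤ.* (+ s ℤ.* + t) ℤ.- + 4 ℤ.* (+ u ℤ.* + v)
        ≡⟨ cong (λ x → r ℤ.+ + 4 ℤ.* x ℤ.- + 4 ℤ.* (+ u ℤ.* + v)) ST≡UV ⟩
      r ℤ.+ + 4 ℤ.* (+ u ℤ.* + v) ℤ.- + 4 ℤ.* (+ u ℤ.* + v)
        ≡⟨ cancel r (+ u ℤ.* + v) ⟩
      r ∎) ,
    subst (0ℤ ℤ.<_) (sym (simplify (+ q₁) (+ q₂) (+ s) (+ t) (+ u) (+ v)))
      (ℤ.+-mono-≤-< (square-nonNeg (+ t ℤ.- + s)) positive)
    where
    open ≡-Reasoning
    r = dist² (+ (q₁ + t) , + (q₂ + u + v)) (+ (q₁ + s) , + q₂)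
    expand : ∀ a b c d s t u v →
      (a ℤ.+ s ℤ.+ t ℤ.- a) ℤ.* (a ℤ.+ s ℤ.+ t ℤ.- a)
        ℤ.+ (b ℤ.+ v ℤ.- (b ℤ.+ u)) ℤ.* (b ℤ.+ v ℤ.- (b ℤ.+ u)) ≡
      (c ℤ.+ t ℤ.- (c ℤ.+ s)) ℤ.* (c ℤ.+ t ℤ.- (c ℤ.+ s))
        ℤ.+ (d ℤ.+ u ℤ.+ v ℤ.- d) ℤ.* (d ℤ.+ u ℤ.+ v ℤ.- d)
        ℤ.+ + 4 ℤ.* (s ℤ.* t) ℤ.- + 4 ℤ.* (u ℤ.* v)
    expand = ℤ-Ring.solve-∀
    simplify : ∀ c d s t u v →
      (c ℤ.+ t ℤ.- (c ℤ.+ s)) ℤ.* (c ℤ.+ t ℤ.- (c ℤ.+ s))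
        ℤ.+ (d ℤ.+ u ℤ.+ v ℤ.- d) ℤ.* (d ℤ.+ u ℤ.+ v ℤ.- d) ≡
      (t ℤ.- s) ℤ.* (t ℤ.- s) ℤ.+ (v ℤ.+ u) ℤ.* (v ℤ.+ u)
    simplify = ℤ-Ring.solve-∀
    cancel : ∀ x y → x ℤ.+ + 4 ℤ.* y ℤ.- + 4 ℤ.* y ≡ x
    cancel = ℤ-Ring.solve-∀
    ST≡UV : + s ℤ.* + t ≡ + u ℤ.* + v
    ST≡UV = trans (sym (ℤ.pos-* s t)) (trans (cong +_ st≡uv) (ℤ.pos-* u v))
    positive : 0ℤ ℤ.< (+ v ℤ.+ + u) ℤ.* (+ v ℤ.+ + u)
    positive = ℤ.+<+ (s≤s z≤n)

  -- The first two sums together exceed the third by 2 q, which determines q and then s and t.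
  recover : ∀ {q q′ s s′ t t′} → q + t ≡ q′ + t′ → q + s ≡ q′ + s′ → s + t ≡ s′ + t′ →
    q ≡ q′ × s ≡ s′ × t ≡ t′
  recover {q} {q′} {s} {s′} {t} {t′} e₁ e₂ e₃ =
    q≡q′ , +-cancelˡ-≡ q s s′ (trans e₂ (cong (_+ s′) (sym q≡q′))) ,
    +-cancelˡ-≡ q t t′ (trans e₁ (cong (_+ t′) (sym q≡q′)))
    where
    open ≡-Reasoning
    regroup : ∀ q s t → 2 * q + (s + t) ≡ (q + t) + (q + s)
    regroup = solve-∀
    q≡q′ : q ≡ q′
    q≡q′ = *-cancelˡ-≡ q q′ 2 (+-cancelʳ-≡ (s + t) (2 * q) (2 * q′) (begin
      2 * q + (s + t)     ≡⟨ regroup q s t ⟩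
      (q + t) + (q + s)   ≡⟨ cong₂ _+_ e₁ e₂ ⟩
      (q′ + t′) + (q′ + s′) ≡⟨ regroup q′ s′ t′ ⟨
      2 * q′ + (s′ + t′)  ≡⟨ cong (λ x → 2 * q′ + x) e₃ ⟨
      2 * q′ + (s + t)    ∎))

  -- `recover` serves once on each axis: the first coordinates yield q₁, s, t after the base p₁ is
  -- dropped, and the second ones p₂, u, v after q₂ is dropped.
  quadruple-injective : ∀ {p₁ p₂ q₁ q₂ s t u v p₁′ p₂′ q₁′ q₂′ s′ t′ u′ v′} →
    quadruple p₁ p₂ q₁ q₂ s t u v ≡ quadruple p₁′ p₂′ q₁′ q₂′ s′ t′ u′ v′ →
    (p₁ ≡ p₁′ × p₂ ≡ p₂′) × (q₁ ≡ q₁′ × q₂ ≡ q₂′) × (s ≡ s′ × t ≡ t′ × u ≡ u′ × v ≡ v′)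
  quadruple-injective {p₁} {p₂} {q₁} {q₂} {s} {t} {u} {v} {p₁′} {p₂′} {q₁′} {q₂′} {s′} {t′} {u′} {v′} e =
    combine
      (recover (coordinate (proj₁ ∘ b)) (coordinate (proj₁ ∘ q))
        (drop-base (coordinate (proj₁ ∘ p)) (coordinate (proj₁ ∘ a))))
      (recover (coordinate (proj₂ ∘ a)) (coordinate (proj₂ ∘ p))
        (drop-base (coordinate (proj₂ ∘ q)) (coordinate (proj₂ ∘ b))))
    where
    open ≡-Reasoning
    a p b q : Quadruple → Point
    a = proj₁
    p = proj₁ ∘ proj₂
    b = proj₁ ∘ proj₂ ∘ proj₂
    q = proj₂ ∘ proj₂ ∘ proj₂
    -- Absolute values turn the equation of integer coordinates into one of natural numbers.
    coordinate : ∀ (f : Quadruple → ℤ) → ℤ.∣ f (quadruple p₁ p₂ q₁ q₂ s t u v) ∣ ≡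
      ℤ.∣ f (quadruple p₁′ p₂′ q₁′ q₂′ s′ t′ u′ v′) ∣
    coordinate f = cong (ℤ.∣_∣ ∘ f) e
    drop-base : ∀ {x x′ y y′ z z′} → x ≡ x′ → x + y + z ≡ x′ + y′ + z′ → y + z ≡ y′ + z′
    drop-base {x} {y = y} {y′} {z} {z′} refl e = +-cancelˡ-≡ x (y + z) (y′ + z′)
      (trans (sym (+-assoc x y z)) (trans e (+-assoc x y′ z′)))
    combine : q₁ ≡ q₁′ × s ≡ s′ × t ≡ t′ → p₂ ≡ p₂′ × u ≡ u′ × v ≡ v′ → _
    combine (q₁≡ , s≡ , t≡) (p₂≡ , u≡ , v≡) =
      (coordinate (proj₁ ∘ p) , p₂≡) , (q₁≡ , coordinate (proj₂ ∘ q)) , (s≡ , t≡ , u≡ , v≡)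

  -- For coprime α and β, the greatest common divisor of g α and g β is g.
  coprime-scaling-injective : ∀ {g g′ α α′ β β′} → Coprime α β → Coprime α′ β′ →
    g * α ≡ g′ * α′ → g * β ≡ g′ * β′ → g ≡ g′
  coprime-scaling-injective {g} {g′} {α} {α′} {β} {β′} c c′ e₁ e₂ = begin
    g                      ≡⟨ scale g c ⟩
    gcd (g * α) (g * β)    ≡⟨ cong₂ gcd e₁ e₂ ⟩
    gcd (g′ * α′) (g′ * β′) ≡⟨ scale g′ c′ ⟨
    g′                     ∎
    where
    open ≡-Reasoning
    scale : ∀ g {α β} → Coprime α β → g ≡ gcd (g * α) (g * β)
    scale g {α} {β} c = begin
      g                   ≡⟨ *-identityʳ g ⟨
      g * 1               ≡⟨ cong (g *_) (coprime⇒gcd≡1 c) ⟨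
      g * gcd α β         ≡⟨ c*gcd[m,n]≡gcd[cm,cn] g α β ⟩
      gcd (g * α) (g * β) ∎

  -- g is recovered as gcd(s, u) and h as gcd(v, t); cancelling g then yields α and β.
  factors-injective : ∀ {k i x y k′ i′ x′ y′} → CoprimePair (x , y) → CoprimePair (x′ , y′) →
    suc k * suc x ≡ suc k′ * suc x′ → suc k * suc y ≡ suc k′ * suc y′ →
    suc i * suc x ≡ suc i′ * suc x′ → suc i * suc y ≡ suc i′ * suc y′ →
    (k , i , x , y) ≡ (k′ , i′ , x′ , y′)
  factors-injective {k} {k′ = k′} c c′ e₁ e₂ e₃ e₄ =
    cong₂ _,_ (suc-injective g≡g′) (cong₂ _,_ (suc-injective (coprime-scaling-injective c c′ e₃ e₄))
      (cong₂ _,_ (suc-injective (cancel g≡g′ e₁)) (suc-injective (cancel g≡g′ e₂))))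
    where
    g≡g′ : suc k ≡ suc k′
    g≡g′ = coprime-scaling-injective c c′ e₁ e₂
    cancel : ∀ {g g′ α α′} .{{_ : NonZero g}} → g ≡ g′ → g * α ≡ g′ * α′ → α ≡ α′
    cancel {g} {α = α} {α′} refl e = *-cancelˡ-≡ α α′ g e

  inRange : ∀ {n N c} → 3 * N * (3 * N) ≤ n → 0 < c → c ≤ 3 * N → InRange n (+ c)
  inRange {n} {N} {c} 9N²≤n 0<c c≤3N = ℤ.+≤+ 0<c ,
    subst (ℤ._≤ + n) (ℤ.pos-* c c) (ℤ.+≤+ (≤-trans (*-mono-≤ c≤3N c≤3N) 9N²≤n))

  -- The bases (p₁ , p₂) and (q₁ , q₂) range over [1, N]² and s, t, u, v are at most N. A coordinate
  -- of `quadruple` has at most three such summands, hence the 3 N.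
  ∣Q∣-lower : ∀ n N → 3 * N * (3 * N) ≤ n →
    N * N * (N * N) * length (factors N) ≤ ∣Q∣ n
  ∣Q∣-lower n N 9N²≤n = subst (_≤ ∣Q∣ n) size
    (length-≤-relation (λ x t → φ x ≡ t) unique
      (λ {x} x∈ → φ x , Equivalence.from (∈-Q n (φ x)) (inQ x∈) , refl)
      (λ { x∈ x′∈ refl e → sym (injective x′∈ x∈ e) }))
    where
    points = positivePairs N
    parameters = cartesianProduct points (cartesianProduct points (factors N))
    size : length parameters ≡ N * N * (N * N) * length (factors N)
    size = begin
      length parameters
        ≡⟨ length-× points (cartesianProduct points (factors N)) ⟩
      length points * length (cartesianProduct points (factors N))
        ≡⟨ cong (length points *_) (length-× points (factors N)) ⟩
      length points * (length points * length (factors N))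
        ≡⟨ *-assoc (length points) (length points) _ ⟨
      length points * length points * length (factors N)
        ≡⟨ cong (λ x → x * x * length (factors N)) (length-positivePairs N) ⟩
      N * N * (N * N) * length (factors N) ∎
      where open ≡-Reasoning
    unique : Unique parameters
    unique = Unique.cartesianProduct⁺ (positivePairs-unique N)
      (Unique.cartesianProduct⁺ (positivePairs-unique N) (factors-unique N))
    φ : (ℕ × ℕ) × (ℕ × ℕ) × (ℕ × ℕ × ℕ × ℕ) → Quadruple
    φ ((p₁ , p₂) , (q₁ , q₂) , (k , i , x , y)) =
      quadruple (suc p₁) (suc p₂) (suc q₁) (suc q₂)
        (suc k * suc x) (suc i * suc y) (suc k * suc y) (suc i * suc x)
    record Valid (x : (ℕ × ℕ) × (ℕ × ℕ) × (ℕ × ℕ × ℕ × ℕ)) : Set where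
      constructor valid
      p₁ = proj₁ (proj₁ x)
      p₂ = proj₂ (proj₁ x)
      q₁ = proj₁ (proj₁ (proj₂ x))
      q₂ = proj₂ (proj₁ (proj₂ x))
      k = proj₁ (proj₂ (proj₂ x))
      i = proj₁ (proj₂ (proj₂ (proj₂ x)))
      α = suc (proj₁ (proj₂ (proj₂ (proj₂ (proj₂ x)))))
      β = suc (proj₂ (proj₂ (proj₂ (proj₂ (proj₂ x)))))
      field
        p₁< : p₁ < N
        p₂< : p₂ < N
        q₁< : q₁ < N
        q₂< : q₂ < N
        i≤k : i ≤ k
        α≤ : α ≤ N / suc k
        β≤ : β ≤ N / suc k
        coprime : Coprime α β
    ∈⇒valid : ∀ {x} → x ∈ parameters → Valid x
    ∈⇒valid {(p₁ , p₂) , (q₁ , q₂) , (k , i , x , y)} m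
      with p∈ , m ← ∈-cartesianProduct⁻ points (cartesianProduct points (factors N)) m
      with q∈ , m ← ∈-cartesianProduct⁻ points (factors N) m
      with k<N , m ← ∈-⨆⁻ {n = N} _ m
      with i∈ , m ← ∈-cartesianProduct⁻ (upTo (suc k)) (coprimePairs (N / suc k)) m
      with m , c ← ∈-filter⁻ CoprimePair? {xs = positivePairs (N / suc k)} m
      with x∈ , y∈ ← ∈-cartesianProduct⁻ (upTo (N / suc k)) (upTo (N / suc k)) m
      with p₁∈ , p₂∈ ← ∈-cartesianProduct⁻ (upTo N) (upTo N) p∈
      with q₁∈ , q₂∈ ← ∈-cartesianProduct⁻ (upTo N) (upTo N) q∈
      = valid (∈-upTo⁻ p₁∈) (∈-upTo⁻ p₂∈) (∈-upTo⁻ q₁∈) (∈-upTo⁻ q₂∈)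
          (≤-pred (∈-upTo⁻ i∈)) (∈-upTo⁻ x∈) (∈-upTo⁻ y∈) c
    inQ : ∀ {x} → x ∈ parameters → InQ n (φ x)
    inQ {x} x∈ =
      ((three (s≤s z≤n) p₁< (scaled α≤) (scaled′ β≤) , two (s≤s z≤n) p₂< (scaled′ α≤)) ,
       (one (s≤s z≤n) p₁< , two (s≤s z≤n) p₂< (scaled β≤)) ,
       (two (s≤s z≤n) q₁< (scaled′ β≤) , three (s≤s z≤n) q₂< (scaled β≤) (scaled′ α≤)) ,
       (two (s≤s z≤n) q₁< (scaled α≤) , one (s≤s z≤n) q₂<)) ,
      quadruple-equalPositive (suc p₁) (suc p₂) (suc q₁) (suc q₂) _ _ _ _
        (interchange (suc k) α (suc i) β) (s≤s z≤n)
      where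
      open Valid (∈⇒valid x∈)
      interchange : ∀ g α h β → g * α * (h * β) ≡ g * β * (h * α)
      interchange = solve-∀
      scaled : ∀ {γ} → γ ≤ N / suc k → suc k * γ ≤ N
      scaled γ≤ = ≤-trans (*-monoʳ-≤ (suc k) γ≤) (n*[m/n]≤m N (suc k))
      -- As h ≤ g, the products with h inherit the bound N from those with g.
      scaled′ : ∀ {γ} → γ ≤ N / suc k → suc i * γ ≤ N
      scaled′ {γ} γ≤ = ≤-trans (*-monoˡ-≤ γ (s≤s i≤k)) (scaled γ≤)
      3N : N + N + N ≡ 3 * N
      3N = trans (+-assoc N N N) (cong (λ x → N + (N + x)) (sym (+-identityʳ N)))
      three : ∀ {c d e} → 0 < c → c ≤ N → d ≤ N → e ≤ N → InRange n (+ (c + d + e))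
      three {c} {d} {e} 0<c c≤ d≤ e≤ = inRange {N = N} 9N²≤n
        (≤-trans 0<c (≤-trans (m≤m+n c d) (m≤m+n (c + d) e)))
        (≤-trans (+-mono-≤ (+-mono-≤ c≤ d≤) e≤) (≤-reflexive 3N))
      two : ∀ {c d} → 0 < c → c ≤ N → d ≤ N → InRange n (+ (c + d))
      two {c} {d} 0<c c≤ d≤ = subst (λ x → InRange n (+ x)) (+-identityʳ (c + d)) (three 0<c c≤ d≤ z≤n)
      one : ∀ {c} → 0 < c → c ≤ N → InRange n (+ c)
      one {c} 0<c c≤ = subst (λ x → InRange n (+ x)) (+-identityʳ c) (two 0<c c≤ z≤n)
    injective : ∀ {x x′} → x ∈ parameters → x′ ∈ parameters → φ x ≡ φ x′ → x ≡ x′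
    injective {(p₁ , p₂) , (q₁ , q₂) , (k , i , x , y)} {(p₁′ , p₂′) , (q₁′ , q₂′) , (k′ , i′ , x′ , y′)} x∈ x′∈ e =
      let (p₁≡ , p₂≡) , (q₁≡ , q₂≡) , (s≡ , t≡ , u≡ , v≡) =
            quadruple-injective {suc p₁} {suc p₂} {suc q₁} {suc q₂} {p₁′ = suc p₁′} {suc p₂′} {suc q₁′} {suc q₂′} e
      in cong₂ _,_ (cong₂ _,_ (suc-injective p₁≡) (suc-injective p₂≡))
        (cong₂ _,_ (cong₂ _,_ (suc-injective q₁≡) (suc-injective q₂≡))
          (factors-injective (Valid.coprime (∈⇒valid x∈)) (Valid.coprime (∈⇒valid x′∈)) s≡ u≡ v≡ t≡))

  -- Candidates for the solutions of s t = u v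

  -- Two sides of a square, covering the pairs with maximum `μ`. The corner is listed twice, which
  -- an upper bound tolerates.
  shell : ℕ → List (ℕ × ℕ)
  shell μ = map (_, μ) (upTo (suc μ)) ++ map (μ ,_) (upTo (suc μ))

  length-shell : ∀ μ → length (shell μ) ≡ suc μ + suc μ
  length-shell μ = trans (length-++ (map (_, μ) (upTo (suc μ))))
    (cong₂ _+_ (side (_, μ)) (side (μ ,_)))
    where
    side : (f : ℕ → ℕ × ℕ) → length (map f (upTo (suc μ))) ≡ suc μ
    side f = trans (length-map f (upTo (suc μ))) (length-upTo (suc μ))

  -- An element (i , (α , β) , (g , h)) has max(α , β) = suc i, and g, h ≤ N / suc i.
  magnitudes : ℕ → List (ℕ × (ℕ × ℕ) × (ℕ × ℕ))
  magnitudes N = ⨆ N (λ i → cartesianProduct (shell (suc i))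
    (cartesianProduct (upTo (suc (N / suc i))) (upTo (suc (N / suc i)))))

  -- With μ = i + 1 ≤ N and M = ⌊N/μ⌋ ≥ 1, the shell has at most 4 μ entries and there are at most 4
  -- M² pairs (g , h), zeros included; and μ M ≤ N.
  few-magnitudes : ∀ N → length (magnitudes N) ≤ 16 * N * ∑⌊ N / N ⌋
  few-magnitudes N = begin
    length (magnitudes N)               ≡⟨ length-⨆ N block ⟩
    ∑ N (length ∘ block)                ≤⟨ ∑-mono N term ⟩
    ∑ N (λ i → 16 * N * (N / suc i))    ≡⟨ ∑-*ˡ N (16 * N) _ ⟩
    16 * N * ∑⌊ N / N ⌋                 ∎
    where
    open ≤-Reasoning
    block : ℕ → List ((ℕ × ℕ) × (ℕ × ℕ))
    block i = cartesianProduct (shell (suc i))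
      (cartesianProduct (upTo (suc (N / suc i))) (upTo (suc (N / suc i))))
    suc≤double : ∀ {k} → 0 < k → suc k ≤ 2 * k
    suc≤double {k} 0<k = +-mono-≤ 0<k (m≤m+n k 0)
    term : ∀ i → i < N → length (block i) ≤ 16 * N * (N / suc i)
    term i i<N = begin
      length (block i) ≡⟨ length-× (shell μ) (cartesianProduct (upTo (suc M)) (upTo (suc M))) ⟩
      length (shell μ) * length (cartesianProduct (upTo (suc M)) (upTo (suc M)))
        ≡⟨ cong₂ _*_ (length-shell μ) (length-positivePairs (suc M)) ⟩
      (suc μ + suc μ) * (suc M * suc M)
        ≤⟨ *-mono-≤ (+-mono-≤ μ-bound μ-bound) (*-mono-≤ M-bound M-bound) ⟩
      (2 * μ + 2 * μ) * (2 * M * (2 * M))                 ≡⟨ lemma μ M ⟩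
      16 * (μ * M) * M                                    ≤⟨ *-monoˡ-≤ M (*-monoʳ-≤ 16 (n*[m/n]≤m N μ)) ⟩
      16 * N * M                                          ∎
      where
      μ = suc i
      M = N / μ
      μ-bound : suc μ ≤ 2 * μ
      μ-bound = suc≤double (s≤s z≤n)
      M-bound : suc M ≤ 2 * M
      M-bound = suc≤double (m≥n⇒m/n>0 i<N)
      lemma : ∀ μ m → (2 * μ + 2 * μ) * (2 * m * (2 * m)) ≡ 16 * (μ * m) * m
      lemma = solve-∀

  signs : List Sign
  signs = Sign.+ ∷ Sign.- ∷ []

  ∈-signs : ∀ σ → σ ∈ signs
  ∈-signs Sign.+ = here refl
  ∈-signs Sign.- = there (here refl)

  signs⁴ : List (Sign × Sign × Sign × Sign)
  signs⁴ = cartesianProduct signs (cartesianProduct signs (cartesianProduct signs signs))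

  -- The tuple is ordered as (s , t , u , v). The signs are free, so s t = - u v also occurs; this
  -- costs only a constant factor.
  signed : (ℕ × (ℕ × ℕ) × (ℕ × ℕ)) × (Sign × Sign × Sign × Sign) → ℤ × ℤ × ℤ × ℤ
  signed ((_ , (α , β) , (g , h)) , (σ₁ , σ₂ , σ₃ , σ₄)) =
    σ₁ ℤ.◃ (g * α) , σ₂ ℤ.◃ (h * β) , σ₃ ℤ.◃ (g * β) , σ₄ ℤ.◃ (h * α)

  solutions : ℕ → List (ℤ × ℤ × ℤ × ℤ)
  solutions N = map signed (cartesianProduct (magnitudes N) signs⁴)

  few-solutions : ∀ N → length (solutions N) ≤ 256 * (N * ∑⌊ N / N ⌋)
  few-solutions N = begin
    length (solutions N)          ≡⟨ length-map signed (cartesianProduct (magnitudes N) signs⁴) ⟩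
    length (cartesianProduct (magnitudes N) signs⁴) ≡⟨ length-× (magnitudes N) signs⁴ ⟩
    length (magnitudes N) * 16    ≤⟨ *-monoˡ-≤ 16 (few-magnitudes N) ⟩
    16 * N * ∑⌊ N / N ⌋ * 16      ≡⟨ lemma N ∑⌊ N / N ⌋ ⟩
    256 * (N * ∑⌊ N / N ⌋)        ∎
    where
    open ≤-Reasoning
    lemma : ∀ n d → 16 * n * d * 16 ≡ 256 * (n * d)
    lemma = solve-∀

  -- One of g, h is at least 1, so its multiple by `μ` shows μ ≤ N.
  factors-≤ : ∀ {N g h} μ → 0 < μ → 0 < g + h → g * μ ≤ N → h * μ ≤ N →
    ∃[ i ] μ ≡ suc i × i < N × g ≤ N / suc i × h ≤ N / suc i
  factors-≤ {N} {g} {h} (suc i) _ 0<g+h gμ≤N hμ≤N =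
    i , refl , i<N g h 0<g+h gμ≤N hμ≤N , *≤⇒≤/ {g} {N} {suc i} gμ≤N , *≤⇒≤/ {h} {N} {suc i} hμ≤N
    where
    i<N : ∀ g h → 0 < g + h → g * suc i ≤ N → h * suc i ≤ N → i < N
    i<N (suc g) h _ gμ≤N _ = ≤-trans (m≤m+n (suc i) _) gμ≤N
    i<N zero (suc h) _ _ hμ≤N = ≤-trans (m≤m+n (suc i) _) hμ≤N

  larger-positive : ∀ {α β} → α ≤ β → 0 < α + β → 0 < β
  larger-positive {β = suc _} _ _ = s≤s z≤n
  larger-positive {zero} {zero} _ ()

  -- Let μ be the larger of α and β. Both g μ and h μ are among the four bounded products, so g and
  -- h are at most ⌊N/μ⌋.
  magnitudes-complete : ∀ {N g h α β} → 0 < g + h → 0 < α + β →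
    g * α ≤ N → h * β ≤ N → g * β ≤ N → h * α ≤ N →
    ∃[ i ] (i , (α , β) , (g , h)) ∈ magnitudes N
  magnitudes-complete {N} {g} {h} {α} {β} 0<g+h 0<α+β gα hβ gβ hα with ≤-total α β
  ... | inj₁ α≤β
    with i , refl , i<N , g≤ , h≤ ← factors-≤ {g = g} {h} β (larger-positive α≤β 0<α+β) 0<g+h gβ hβ
    = i , ∈-⨆⁺ {n = N} _ i<N (∈-cartesianProduct⁺
        (∈-++⁺ˡ (∈-map⁺ (_, β) (∈-upTo⁺ (s≤s α≤β))))
        (∈-cartesianProduct⁺ (∈-upTo⁺ (s≤s g≤)) (∈-upTo⁺ (s≤s h≤))))
  ... | inj₂ β≤α
    with i , refl , i<N , g≤ , h≤ ← factors-≤ {g = g} {h} α (larger-positive β≤α (subst (0 <_) (+-comm α β) 0<α+β)) 0<g+h gα hα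
    = i , ∈-⨆⁺ {n = N} _ i<N (∈-cartesianProduct⁺
        (∈-++⁺ʳ (map (_, α) (upTo (suc α))) (∈-map⁺ (α ,_) (∈-upTo⁺ (s≤s β≤α))))
        (∈-cartesianProduct⁺ (∈-upTo⁺ (s≤s g≤)) (∈-upTo⁺ (s≤s h≤))))

  -- `four-numbers` is applied to the absolute values and the signs are put back afterwards. If g =
  -- h = 0 or α = β = 0, all four numbers would vanish.
  solutions-complete : ∀ {N s t u v} → s ℤ.* t ≡ u ℤ.* v →
    ¬ (s ≡ 0ℤ × t ≡ 0ℤ × u ≡ 0ℤ × v ≡ 0ℤ) →
    ℤ.∣ s ∣ ≤ N → ℤ.∣ t ∣ ≤ N → ℤ.∣ u ∣ ≤ N → ℤ.∣ v ∣ ≤ N →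
    (s , t , u , v) ∈ solutions N
  solutions-complete {N} {s} {t} {u} {v} st≡uv nonzero s≤ t≤ u≤ v≤
    with g , h , α , β , s≡ , u≡ , v≡ , t≡ ←
      four-numbers ℤ.∣ s ∣ ℤ.∣ t ∣ ℤ.∣ u ∣ ℤ.∣ v ∣
        (trans (sym (ℤ.abs-* s t)) (trans (cong ℤ.∣_∣ st≡uv) (ℤ.abs-* u v)))
    = subst (_∈ solutions N)
        (cong₂ _,_ (restore s s≡) (cong₂ _,_ (restore t t≡) (cong₂ _,_ (restore u u≡) (restore v v≡))))
        (∈-map⁺ signed (∈-cartesianProduct⁺
          (proj₂ (magnitudes-complete {g = g} {h} {α} {β} (n≢0⇒n>0 g+h≢0) (n≢0⇒n>0 α+β≢0)
            (subst (_≤ N) s≡ s≤) (subst (_≤ N) t≡ t≤) (subst (_≤ N) u≡ u≤) (subst (_≤ N) v≡ v≤)))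
          (∈-cartesianProduct⁺ (∈-signs (ℤ.sign s)) (∈-cartesianProduct⁺ (∈-signs (ℤ.sign t))
            (∈-cartesianProduct⁺ (∈-signs (ℤ.sign u)) (∈-signs (ℤ.sign v)))))))
    where
    restore : ∀ i {k} → ℤ.∣ i ∣ ≡ k → ℤ.sign i ℤ.◃ k ≡ i
    restore i refl = ℤ.◃-inverse i
    zeroˡ : ∀ {i k l} → ℤ.∣ i ∣ ≡ k * l → k ≡ 0 → i ≡ 0ℤ
    zeroˡ e refl = ℤ.∣i∣≡0⇒i≡0 e
    zeroʳ : ∀ {i k l} → ℤ.∣ i ∣ ≡ k * l → l ≡ 0 → i ≡ 0ℤ
    zeroʳ {k = k} e refl = ℤ.∣i∣≡0⇒i≡0 (trans e (*-zeroʳ k))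
    g+h≢0 : g + h ≢ 0
    g+h≢0 e = nonzero (zeroˡ s≡ g≡0 , zeroˡ t≡ h≡0 , zeroˡ u≡ g≡0 , zeroˡ v≡ h≡0)
      where
      g≡0 = m+n≡0⇒m≡0 g e
      h≡0 = m+n≡0⇒n≡0 g e
    α+β≢0 : α + β ≢ 0
    α+β≢0 e = nonzero (zeroʳ {k = g} s≡ α≡0 , zeroʳ {k = h} t≡ β≡0 , zeroʳ {k = g} u≡ β≡0 , zeroʳ {k = h} v≡ α≡0)
      where
      α≡0 = m+n≡0⇒m≡0 α e
      β≡0 = m+n≡0⇒n≡0 α e

  -- Upper bound for `∣Q∣`

  root-bound : ∀ {n m i} → n < suc m * suc m → InRange n i → ℤ.∣ i ∣ ≤ m
  root-bound {n} {m} {+ c} n< (_ , c²≤n) = ≮⇒≥ λ m<c →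
    <⇒≱ n< (≤-trans (*-mono-≤ m<c m<c) (ℤ.drop‿+≤+ (subst (ℤ._≤ + n) (sym (ℤ.pos-* c c)) c²≤n)))
  root-bound {i = -[1+ _ ]} _ (() , _)

  few-points : ∀ {n m} → n < suc m * suc m → length (𝒫 n) ≤ m * m
  few-points {n} {m} n< = begin
    length (𝒫 n)                           ≡⟨ length-× (coords n) (coords n) ⟩
    length (coords n) * length (coords n)  ≤⟨ *-mono-≤ few-coords few-coords ⟩
    m * m                                  ∎
    where
    open ≤-Reasoning
    index : ∀ {i} → InRange n i → ∃[ k ] k ∈ upTo m × i ≡ + suc k
    index {+ suc k} r = k , ∈-upTo⁺ (root-bound {n} {m} n< r) , refl
    index {+ zero} (ℤ.+≤+ () , _)
    index { -[1+ _ ]} (() , _)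
    few-coords : length (coords n) ≤ m
    few-coords = subst (length (coords n) ≤_) (length-upTo m)
      (length-≤-relation (λ i k → i ≡ + suc k) (coords-unique n)
        (λ {i} i∈ → index (Equivalence.to (∈-coords n i) i∈))
        (λ _ _ e e′ → trans e (sym e′)))

  factored : Quadruple → ℤ × ℤ × ℤ × ℤ
  factored ((a₁ , a₂) , (p₁ , p₂) , (b₁ , b₂) , (q₁ , q₂)) = x ℤ.- z , x ℤ.+ z , w ℤ.- y , w ℤ.+ y
    where
    x = a₁ ℤ.- p₁
    y = a₂ ℤ.- p₂
    z = b₁ ℤ.- q₁
    w = b₂ ℤ.- q₂

  sum-difference-injective : ∀ {x z x′ z′} → x ℤ.- z ≡ x′ ℤ.- z′ → x ℤ.+ z ≡ x′ ℤ.+ z′ →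
    x ≡ x′ × z ≡ z′
  sum-difference-injective {x} {z} {x′} {z′} e₁ e₂ =
    ℤ.*-cancelˡ-≡ (+ 2) x x′ (trans (twice-x x z) (trans (cong₂ ℤ._+_ e₁ e₂) (sym (twice-x x′ z′)))) ,
    ℤ.*-cancelˡ-≡ (+ 2) z z′ (trans (twice-z x z) (trans (cong₂ ℤ._-_ e₂ e₁) (sym (twice-z x′ z′))))
    where
    twice-x : ∀ x z → + 2 ℤ.* x ≡ (x ℤ.- z) ℤ.+ (x ℤ.+ z)
    twice-x = ℤ-Ring.solve-∀
    twice-z : ∀ x z → + 2 ℤ.* z ≡ (x ℤ.+ z) ℤ.- (x ℤ.- z)
    twice-z = ℤ-Ring.solve-∀

  -- Coordinate differences are at most 2 m in absolute value, so their sums and differences are at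
  -- most 4 m. If all four factors vanished, then z = w = 0, against |bq| > 0.
  factored-∈-solutions : ∀ {n m} t → n < suc m * suc m → InQ n t → factored t ∈ solutions (4 * m)
  factored-∈-solutions {n} {m} ((a₁ , a₂) , (p₁ , p₂) , (b₁ , b₂) , (q₁ , q₂)) n<
    (((a₁∈ , a₂∈) , (p₁∈ , p₂∈) , (b₁∈ , b₂∈) , (q₁∈ , q₂∈)) , equal , positive) =
    solutions-complete product nonzero 
      (∣i-j∣≤4m x z x≤ z≤) (∣i+j∣≤4m x z x≤ z≤) (∣i-j∣≤4m w y w≤ y≤) (∣i+j∣≤4m w y w≤ y≤)
    where
    x = a₁ ℤ.- p₁
    y = a₂ ℤ.- p₂
    z = b₁ ℤ.- q₁
    w = b₂ ℤ.- q₂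
    left : ∀ x y z → (x ℤ.- z) ℤ.* (x ℤ.+ z) ≡ (x ℤ.* x ℤ.+ y ℤ.* y) ℤ.- (z ℤ.* z ℤ.+ y ℤ.* y)
    left = ℤ-Ring.solve-∀
    right : ∀ y z w → (w ℤ.- y) ℤ.* (w ℤ.+ y) ≡ (z ℤ.* z ℤ.+ w ℤ.* w) ℤ.- (z ℤ.* z ℤ.+ y ℤ.* y)
    right = ℤ-Ring.solve-∀
    product : (x ℤ.- z) ℤ.* (x ℤ.+ z) ≡ (w ℤ.- y) ℤ.* (w ℤ.+ y)
    product = trans (left x y z) (trans (cong (ℤ._- (z ℤ.* z ℤ.+ y ℤ.* y)) equal) (sym (right y z w)))
    nonzero : ¬ (x ℤ.- z ≡ 0ℤ × x ℤ.+ z ≡ 0ℤ × w ℤ.- y ≡ 0ℤ × w ℤ.+ y ≡ 0ℤ)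
    nonzero (e₁ , e₂ , e₃ , e₄)
      with _ , z≡0 ← sum-difference-injective {x} {z} {0ℤ} {0ℤ} e₁ e₂
      with w≡0 , _ ← sum-difference-injective {w} {y} {0ℤ} {0ℤ} e₃ e₄
      = ℤ.<-irrefl refl (subst (0ℤ ℤ.<_) (cong₂ (λ i j → i ℤ.* i ℤ.+ j ℤ.* j) z≡0 w≡0) positive)
    bound : ∀ i j → InRange n i → InRange n j → ℤ.∣ i ℤ.- j ∣ ≤ m + m
    bound i j i∈ j∈ = ≤-trans (ℤ.∣i-j∣≤∣i∣+∣j∣ i j)
      (+-mono-≤ (root-bound {n} {m} {i} n< i∈) (root-bound {n} {m} {j} n< j∈))
    x≤ = bound a₁ p₁ a₁∈ p₁∈
    y≤ = bound a₂ p₂ a₂∈ p₂∈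
    z≤ = bound b₁ q₁ b₁∈ q₁∈
    w≤ = bound b₂ q₂ b₂∈ q₂∈
    4m : ∀ m → (m + m) + (m + m) ≡ 4 * m
    4m = solve-∀
    ∣i-j∣≤4m : ∀ i j → ℤ.∣ i ∣ ≤ m + m → ℤ.∣ j ∣ ≤ m + m → ℤ.∣ i ℤ.- j ∣ ≤ 4 * m
    ∣i-j∣≤4m i j i≤ j≤ = subst (ℤ.∣ i ℤ.- j ∣ ≤_) (4m m) (≤-trans (ℤ.∣i-j∣≤∣i∣+∣j∣ i j) (+-mono-≤ i≤ j≤))
    ∣i+j∣≤4m : ∀ i j → ℤ.∣ i ∣ ≤ m + m → ℤ.∣ j ∣ ≤ m + m → ℤ.∣ i ℤ.+ j ∣ ≤ 4 * m
    ∣i+j∣≤4m i j i≤ j≤ = subst (ℤ.∣ i ℤ.+ j ∣ ≤_) (4m m) (≤-trans (ℤ.∣i+j∣≤∣i∣+∣j∣ i j) (+-mono-≤ i≤ j≤))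

  factored-injective : ∀ {a p b q a′ b′} → factored (a , p , b , q) ≡ factored (a′ , p , b′ , q) →
    a ≡ a′ × b ≡ b′
  factored-injective {a₁ , a₂} {p₁ , p₂} {b₁ , b₂} {q₁ , q₂} e =
    let x≡ , z≡ = sum-difference-injective (cong proj₁ e) (cong (proj₁ ∘ proj₂) e)
        w≡ , y≡ = sum-difference-injective (cong (proj₁ ∘ proj₂ ∘ proj₂) e) (cong (proj₂ ∘ proj₂ ∘ proj₂) e)
    in cong₂ _,_ (cancel x≡) (cancel y≡) , cong₂ _,_ (cancel z≡) (cancel w≡)
    where
    cancel : ∀ {i j k} → i ℤ.- k ≡ j ℤ.- k → i ≡ j
    cancel {i} {j} {k} e = trans (restore i k) (trans (cong (ℤ._+ k) e) (sym (restore j k)))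
      where
      restore : ∀ i k → i ≡ i ℤ.- k ℤ.+ k
      restore = ℤ-Ring.solve-∀

  -- A quadruple is determined by p, q and its image under `factored`: the latter gives a - p and b
  -- - q. There are at most m² choices for each of p and q.
  ∣Q∣-upper : ∀ n m → n < suc m * suc m →
    ∣Q∣ n ≤ (m * m) * (m * m) * (256 * (4 * m * ∑⌊ 4 * m / 4 * m ⌋))
  ∣Q∣-upper n m n< = begin
    ∣Q∣ n
      ≤⟨ length-≤-relation (λ t y → f t ≡ y) (Q-unique n) (λ {t} t∈ → f t , f∈ t t∈ , refl)
           (λ { {t} {t′} _ _ refl e → f-injective (sym e) }) ⟩
    length (cartesianProduct (𝒫 n) (cartesianProduct (𝒫 n) (solutions (4 * m))))
      ≡⟨ trans (length-× (𝒫 n) (cartesianProduct (𝒫 n) (solutions (4 * m))))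
           (cong (length (𝒫 n) *_) (length-× (𝒫 n) (solutions (4 * m)))) ⟩
    length (𝒫 n) * (length (𝒫 n) * length (solutions (4 * m)))
      ≡⟨ *-assoc (length (𝒫 n)) (length (𝒫 n)) _ ⟨
    length (𝒫 n) * length (𝒫 n) * length (solutions (4 * m))
      ≤⟨ *-mono-≤ (*-mono-≤ (few-points {n} {m} n<) (few-points {n} {m} n<)) (few-solutions (4 * m)) ⟩
    (m * m) * (m * m) * (256 * (4 * m * ∑⌊ 4 * m / 4 * m ⌋)) ∎
    where
    open ≤-Reasoning
    f : Quadruple → Point × Point × (ℤ × ℤ × ℤ × ℤ)
    f t@(a , p , b , q) = p , q , factored t
    f∈ : ∀ t → t ∈ Q n → f t ∈ cartesianProduct (𝒫 n) (cartesianProduct (𝒫 n) (solutions (4 * m)))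
    f∈ t@(a , p , b , q) t∈ with inQ@((_ , p∈ , _ , q∈) , _) ← Equivalence.to (∈-Q n t) t∈ =
      ∈-cartesianProduct⁺ (Equivalence.from (∈-𝒫 n p) p∈)
        (∈-cartesianProduct⁺ (Equivalence.from (∈-𝒫 n q) q∈) (factored-∈-solutions {n} {m} t n< inQ))
    f-injective : ∀ {t t′} → f t ≡ f t′ → t ≡ t′
    f-injective {a , p , b , q} {a′ , p′ , b′ , q′} e
      with refl ← cong proj₁ e | refl ← cong (proj₁ ∘ proj₂) e =
      let a≡ , b≡ = factored-injective {a} {p} {b} {q} {a′} {b′} (cong (proj₂ ∘ proj₂) e)
      in cong₂ _,_ a≡ (cong₂ (λ b q → p , b , q) b≡ refl)

  -- Dyadic bounds for the Darboux sums of log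

  ∑ℚ : ℕ → (ℕ → ℚᵘ) → ℚᵘ
  ∑ℚ n f = sumℚᵘ (applyUpTo f n)

  ∑ℚ-+ : ∀ a b f → ∑ℚ (a + b) f ≃ ∑ℚ a f ℚᵘ.+ ∑ℚ b (λ i → f (a + i))
  ∑ℚ-+ zero b f = ℚᵘ.≃-sym (ℚᵘ.+-identityˡ _)
  ∑ℚ-+ (suc a) b f = ℚᵘ.≃-trans (ℚᵘ.+-congʳ (f 0) (∑ℚ-+ a b (f ∘ suc))) (ℚᵘ.≃-sym (ℚᵘ.+-assoc (f 0) _ _))

  ∑ℚ-nonNeg : ∀ n f → (∀ i → 0ℚᵘ ℚᵘ.≤ f i) → 0ℚᵘ ℚᵘ.≤ ∑ℚ n f
  ∑ℚ-nonNeg zero f _ = ℚᵘ.≤-refl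
  ∑ℚ-nonNeg (suc n) f 0≤f = ℚᵘ.+-mono-≤ (0≤f 0) (∑ℚ-nonNeg n (f ∘ suc) (0≤f ∘ suc))

  ∑ℚ-extend : ∀ {a b} f → (∀ i → 0ℚᵘ ℚᵘ.≤ f i) → a ≤ b → ∑ℚ a f ℚᵘ.≤ ∑ℚ b f
  ∑ℚ-extend {a} {b} f 0≤f a≤b = begin
    ∑ℚ a f                                        ≃⟨ ℚᵘ.+-identityʳ _ ⟨
    ∑ℚ a f ℚᵘ.+ 0ℚᵘ                               ≤⟨ ℚᵘ.+-monoʳ-≤ (∑ℚ a f) (∑ℚ-nonNeg (b ∸ a) _ (λ i → 0≤f (a + i))) ⟩
    ∑ℚ a f ℚᵘ.+ ∑ℚ (b ∸ a) (λ i → f (a + i))      ≃⟨ ∑ℚ-+ a (b ∸ a) f ⟨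
    ∑ℚ (a + (b ∸ a)) f                            ≡⟨ cong (λ x → ∑ℚ x f) (m+[n∸m]≡n a≤b) ⟩
    ∑ℚ b f                                        ∎
    where open ℚᵘ.≤-Reasoning

  +-same-denominator : ∀ l d → mkℚᵘ 1ℤ d ℚᵘ.+ mkℚᵘ (+ l) d ≃ mkℚᵘ (+ suc l) d
  +-same-denominator l d = *≡* (lemma (+ l) (+ suc d))
    where
    lemma : ∀ l D → (1ℤ ℤ.* D ℤ.+ l ℤ.* D) ℤ.* D ≡ (1ℤ ℤ.+ l) ℤ.* (D ℤ.* D)
    lemma = ℤ-Ring.solve-∀

  ∑ℚ-upper : ∀ l d {f} → (∀ i → i < l → f i ℚᵘ.≤ mkℚᵘ 1ℤ d) → ∑ℚ l f ℚᵘ.≤ mkℚᵘ (+ l) d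
  ∑ℚ-upper zero d _ = *≤* ℤ.≤-refl
  ∑ℚ-upper (suc l) d f≤ = ℚᵘ.≤-respʳ-≃ (+-same-denominator l d)
    (ℚᵘ.+-mono-≤ (f≤ 0 (s≤s z≤n)) (∑ℚ-upper l d (λ i i<l → f≤ (suc i) (s≤s i<l))))

  ∑ℚ-lower : ∀ l d {f} → (∀ i → i < l → mkℚᵘ 1ℤ d ℚᵘ.≤ f i) → mkℚᵘ (+ l) d ℚᵘ.≤ ∑ℚ l f
  ∑ℚ-lower zero d _ = *≤* ℤ.≤-refl
  ∑ℚ-lower (suc l) d ≤f = ℚᵘ.≤-respˡ-≃ (+-same-denominator l d)
    (ℚᵘ.+-mono-≤ (≤f 0 (s≤s z≤n)) (∑ℚ-lower l d (λ i i<l → ≤f (suc i) (s≤s i<l))))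

  unit-fraction-antitone : ∀ {d e} → d ≤ e → mkℚᵘ 1ℤ e ℚᵘ.≤ mkℚᵘ 1ℤ d
  unit-fraction-antitone d≤e = *≤* (ℤ.*-monoˡ-≤-nonNeg 1ℤ (ℤ.+≤+ (s≤s d≤e)))

  fraction-nonNeg : ∀ m d → 0ℚᵘ ℚᵘ.≤ mkℚᵘ (+ m) d
  fraction-nonNeg m d = *≤* (subst (ℤ._≤ + m ℤ.* 1ℤ) (sym (ℤ.*-zeroˡ (+ suc d))) (subst (0ℤ ℤ.≤_) (ℤ.pos-* m 1) (ℤ.+≤+ z≤n)))

  fraction≃1 : ∀ d → mkℚᵘ (+ suc d) d ≃ fromℕ 1
  fraction≃1 d = *≡* (ℤ.*-comm (+ suc d) 1ℤ)

  -- `mkℚᵘ` stores the denominator minus one, so `d + suc d` stands for 2 (d + 1).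
  ½≃fraction : ∀ d → mkℚᵘ 1ℤ 1 ≃ mkℚᵘ (+ suc d) (d + suc d)
  ½≃fraction d = *≡* (lemma (+ suc d))
    where
    lemma : ∀ D → 1ℤ ℤ.* (D ℤ.+ D) ≡ D ℤ.* + 2
    lemma = ℤ-Ring.solve-∀

  -- This cuts [1, 2^(l+1)] at 2^l. The second part has 2^l K intervals of length 1/K.
  dyadic-split : ∀ l K → (2 ^ suc l ∸ 1) * K ≡ (2 ^ l ∸ 1) * K + suc (2 ^ l ∸ 1) * K
  dyadic-split l K = trans
    (cong (_* K) (trans (2^[1+l]∸1≡ l) (cong (λ x → 2 ^ l ∸ 1 + x) (sym (1+[2^l∸1]≡2^l l)))))
    (*-distribʳ-+ K (2 ^ l ∸ 1) (suc (2 ^ l ∸ 1)))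

  module _ (k : ℕ) where
    private
      K = suc k
      lowerTerm upperTerm : ℕ → ℚᵘ
      lowerTerm i = 1ℤ ℚᵘ./ (suc k + suc i)
      upperTerm i = 1ℤ ℚᵘ./ (suc k + i)
      extend : ∀ {n n′} → n ≤ n′ → (n ∸ 1) * K ≤ (n′ ∸ 1) * K
      extend n≤n′ = *-monoˡ-≤ K (∸-monoˡ-≤ 1 n≤n′)

    -- With d + 1 = 2^l K, the interval [2^l, 2^(l+1)] contributes d + 1 terms, each at most 1/(d +
    -- 1), so at most 1 in total.
    lowerTerms≤ : ∀ l → ∑ℚ ((2 ^ l ∸ 1) * K) lowerTerm ℚᵘ.≤ fromℕ l
    lowerTerms≤ zero = ℚᵘ.≤-refl
    lowerTerms≤ (suc l) = begin
      ∑ℚ ((2 ^ suc l ∸ 1) * K) lowerTerm    ≡⟨ cong (λ x → ∑ℚ x lowerTerm) (dyadic-split l K) ⟩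
      ∑ℚ (a * K + suc d) lowerTerm          ≃⟨ ∑ℚ-+ (a * K) (suc d) lowerTerm ⟩
      ∑ℚ (a * K) lowerTerm ℚᵘ.+ ∑ℚ (suc d) (λ i → lowerTerm (a * K + i))
        ≤⟨ ℚᵘ.+-mono-≤ (lowerTerms≤ l) (∑ℚ-upper (suc d) d (λ i _ →
             unit-fraction-antitone (+-monoʳ-≤ k (≤-trans (m≤m+n (a * K) i) (n≤1+n _))))) ⟩
      fromℕ l ℚᵘ.+ mkℚᵘ (+ suc d) d         ≃⟨ ℚᵘ.+-congʳ (fromℕ l) (fraction≃1 d) ⟩
      fromℕ l ℚᵘ.+ fromℕ 1                  ≃⟨ ℚᵘ.+-comm (fromℕ l) (fromℕ 1) ⟩
      fromℕ 1 ℚᵘ.+ fromℕ l                  ≃⟨ +-same-denominator l 0 ⟩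
      fromℕ (suc l)                         ∎
      where
      open ℚᵘ.≤-Reasoning
      a = 2 ^ l ∸ 1
      d = k + a * K

    lowerSum≤ : ∀ {n} l → n ≤ 2 ^ l → lowerSum n k ℚᵘ.≤ fromℕ l
    lowerSum≤ {n} l n≤2^l = begin
      lowerSum n k                       ≡⟨ cong sumℚᵘ (map-upTo lowerTerm ((n ∸ 1) * K)) ⟩
      ∑ℚ ((n ∸ 1) * K) lowerTerm         ≤⟨ ∑ℚ-extend lowerTerm (λ i → fraction-nonNeg 1 (k + suc i)) (extend n≤2^l) ⟩
      ∑ℚ ((2 ^ l ∸ 1) * K) lowerTerm     ≤⟨ lowerTerms≤ l ⟩
      fromℕ l                            ∎
      where open ℚᵘ.≤-Reasoning

    -- With d + 1 = 2^l K, the interval [2^l, 2^(l+1)] contributes d + 1 terms, each at least 1/(2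
    -- (d + 1)), so at least 1/2 in total.
    ≤upperTerms : ∀ l → mkℚᵘ (+ l) 1 ℚᵘ.≤ ∑ℚ ((2 ^ l ∸ 1) * K) upperTerm
    ≤upperTerms zero = *≤* ℤ.≤-refl
    ≤upperTerms (suc l) = begin
      mkℚᵘ (+ suc l) 1                      ≃⟨ +-same-denominator l 1 ⟨
      mkℚᵘ 1ℤ 1 ℚᵘ.+ mkℚᵘ (+ l) 1           ≃⟨ ℚᵘ.+-comm (mkℚᵘ 1ℤ 1) (mkℚᵘ (+ l) 1) ⟩
      mkℚᵘ (+ l) 1 ℚᵘ.+ mkℚᵘ 1ℤ 1           ≃⟨ ℚᵘ.+-congʳ (mkℚᵘ (+ l) 1) (½≃fraction d) ⟩
      mkℚᵘ (+ l) 1 ℚᵘ.+ mkℚᵘ (+ suc d) (d + suc d)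
        ≤⟨ ℚᵘ.+-mono-≤ (≤upperTerms l) (∑ℚ-lower (suc d) (d + suc d) (λ i i≤d →
             unit-fraction-antitone (subst (_≤ d + suc d) (+-assoc k (a * K) i) (+-monoʳ-≤ d (<⇒≤ i≤d))))) ⟩
      ∑ℚ (a * K) upperTerm ℚᵘ.+ ∑ℚ (suc d) (λ i → upperTerm (a * K + i))
        ≃⟨ ∑ℚ-+ (a * K) (suc d) upperTerm ⟨
      ∑ℚ (a * K + suc d) upperTerm          ≡⟨ cong (λ x → ∑ℚ x upperTerm) (dyadic-split l K) ⟨
      ∑ℚ ((2 ^ suc l ∸ 1) * K) upperTerm    ∎
      where
      open ℚᵘ.≤-Reasoning
      a = 2 ^ l ∸ 1
      d = k + a * K

    ≤upperSum : ∀ {n} l → 2 ^ l ≤ n → mkℚᵘ (+ l) 1 ℚᵘ.≤ upperSum n k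
    ≤upperSum {n} l 2^l≤n = begin
      mkℚᵘ (+ l) 1                       ≤⟨ ≤upperTerms l ⟩
      ∑ℚ ((2 ^ l ∸ 1) * K) upperTerm     ≤⟨ ∑ℚ-extend upperTerm (λ i → fraction-nonNeg 1 (k + i)) (extend 2^l≤n) ⟩
      ∑ℚ ((n ∸ 1) * K) upperTerm         ≡⟨ cong sumℚᵘ (map-upTo upperTerm ((n ∸ 1) * K)) ⟨
      upperSum n k                       ∎
      where open ℚᵘ.≤-Reasoning

  log-lower : ∀ A .{{_ : NonZero A}} {n x q} l → n ≤ 2 ^ l → x * l ≤ A * q →
    (1ℤ ℚᵘ./ A ℚᵘ.* fromℕ x) ·log n ≤ fromℕ q
  log-lower A@(suc A-1) {n} {x} {q} l n≤2^l xl≤Aq k = begin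
    r ℚᵘ.* lowerSum n k   ≤⟨ ℚᵘ.*-monoʳ-≤-nonNeg r {{r≥0}} (lowerSum≤ k l n≤2^l) ⟩
    r ℚᵘ.* fromℕ l        ≤⟨ *≤* (subst₂ ℤ._≤_ (left (+ x) (+ l)) (right (+ A) (+ q)) products) ⟩
    fromℕ q               ∎
    where
    open ℚᵘ.≤-Reasoning
    r = 1ℤ ℚᵘ./ A ℚᵘ.* fromℕ x
    r≥0 : ℚᵘ.NonNegative r
    r≥0 = ℚᵘ.nonNeg*nonNeg⇒nonNeg (1ℤ ℚᵘ./ A) (fromℕ x)
    products : + x ℤ.* + l ℤ.≤ + A ℤ.* + q
    products = subst₂ ℤ._≤_ (ℤ.pos-* x l) (ℤ.pos-* A q) (ℤ.+≤+ xl≤Aq)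
    left : ∀ x l → x ℤ.* l ≡ (1ℤ ℤ.* x) ℤ.* l ℤ.* 1ℤ
    left = ℤ-Ring.solve-∀
    right : ∀ A q → A ℤ.* q ≡ q ℤ.* (A ℤ.* 1ℤ ℤ.* 1ℤ)
    right = ℤ-Ring.solve-∀

  -- The 2 in `q * 2` compensates for the bound l/2 on the upper sums.
  log-upper : ∀ C {n x q} l → 2 ^ l ≤ n → q * 2 ≤ C * x * l →
    fromℕ q ≤ (fromℕ C ℚᵘ.* fromℕ x) ·log n
  log-upper C {n} {x} {q} l 2^l≤n 2q≤Cxl k = begin
    fromℕ q               ≤⟨ *≤* (subst₂ ℤ._≤_ refl (right (+ C ℤ.* + x ℤ.* + l)) products) ⟩
    r ℚᵘ.* mkℚᵘ (+ l) 1   ≤⟨ ℚᵘ.*-monoʳ-≤-nonNeg r {{r≥0}} (≤upperSum k l 2^l≤n) ⟩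
    r ℚᵘ.* upperSum n k   ∎
    where
    open ℚᵘ.≤-Reasoning
    r = fromℕ C ℚᵘ.* fromℕ x
    r≥0 : ℚᵘ.NonNegative r
    r≥0 = ℚᵘ.nonNeg*nonNeg⇒nonNeg (fromℕ C) (fromℕ x)
    products : + q ℤ.* + 2 ℤ.≤ + C ℤ.* + x ℤ.* + l
    products = subst₂ ℤ._≤_ (ℤ.pos-* q 2)
      (trans (ℤ.pos-* (C * x) l) (cong (ℤ._* + l) (ℤ.pos-* C x))) (ℤ.+≤+ 2q≤Cxl)
    right : ∀ i → i ≡ i ℤ.* 1ℤ
    right = ℤ-Ring.solve-∀

  -- Integer logarithms and square roots

  greatest : {P : ℕ → Set} → Decidable P → ∀ b → P 0 → ¬ P b → ∃[ m ] P m × ¬ P (suc m)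
  greatest P? zero p ¬p = contradiction p ¬p
  greatest P? (suc b) p ¬p with P? b
  ... | yes q = b , q , ¬p
  ... | no ¬q = greatest P? b p ¬q

  n<2^n : ∀ n → n < 2 ^ n
  n<2^n zero = s≤s z≤n
  n<2^n (suc n) = +-mono-≤ (m^n>0 2 n) (subst (suc n ≤_) (sym (+-identityʳ _)) (n<2^n n))

  floor-log₂ : ∀ {n} → 2 ≤ n → ∃[ l ] 1 ≤ l × 2 ^ l ≤ n × n < 2 ^ suc l
  floor-log₂ {n} 2≤n with greatest (λ l → 2 ^ l ≤? n) n (≤-trans (s≤s z≤n) 2≤n) (<⇒≱ (n<2^n n))
  ... | zero , _ , 2≰n = contradiction 2≤n 2≰n
  ... | suc l , 2^≤n , ¬≤ = suc l , s≤s z≤n , 2^≤n , ≰⇒> ¬≤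

  floor-sqrt : ∀ n → ∃[ m ] m * m ≤ n × n < suc m * suc m
  floor-sqrt n with m , m²≤n , ¬≤ ← greatest (λ m → m * m ≤? n) (suc n) z≤n (<⇒≱ (m≤m*n (suc n) (suc n)))
    = m , m²≤n , ≰⇒> ¬≤

  -- N = ⌊√n/3⌋, and 36 = (3 · 2)² ensures N ≥ 2. Then n < 9 (N + 1)² ≤ 9 (2 N)².
  floor-third-sqrt : ∀ {n} → 36 ≤ n → ∃[ N ] 2 ≤ N × 3 * N * (3 * N) ≤ n × n ≤ 36 * (N * N)
  floor-third-sqrt {n} 36≤n with greatest (λ N → 3 * N * (3 * N) ≤? n) (suc n) z≤n
    (<⇒≱ (≤-trans (m≤n*m (suc n) 3) (m≤m*n (3 * suc n) (3 * suc n))))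
  ... | zero , _ , ¬≤ = contradiction (≤-trans (m≤m+n 9 27) 36≤n) ¬≤
  ... | suc zero , _ , ¬≤ = contradiction 36≤n ¬≤
  ... | N@(suc (suc _)) , 9N²≤n , ¬≤ = N , s≤s (s≤s z≤n) , 9N²≤n , (begin
    n                                      ≤⟨ <⇒≤ (≰⇒> ¬≤) ⟩
    3 * suc N * (3 * suc N)          ≤⟨ *-mono-≤ (*-monoʳ-≤ 3 1+N≤2N) (*-monoʳ-≤ 3 1+N≤2N) ⟩
    3 * (2 * N) * (3 * (2 * N))  ≡⟨ lemma 3 2 N ⟩
    36 * (N * N)                       ∎)
    where
    open ≤-Reasoning
    1+N≤2N : suc N ≤ 2 * N
    1+N≤2N = +-mono-≤ {1} {N} {N} {N + 0} (s≤s z≤n) (m≤m+n N 0)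
    lemma : ∀ x y N → x * (y * N) * (x * (y * N)) ≡ x * y * (x * y) * (N * N)
    lemma = solve-∀

  -- Collecting the constants

  -- D, F, q stand for Σ ⌊N/k⌋, the number of `factors` and `∣Q∣`. Passing from n³ L to N⁶ l costs
  -- 10 c³, from l N to D costs 4, and from N D to F costs 8.
  lower-arithmetic : ∀ c {n N l L D F q} → n ≤ c * (N * N) → L ≤ 10 * l → l * N ≤ 4 * D →
    N * D ≤ 8 * F → N * N * (N * N) * F ≤ q → n ^ 3 * L ≤ c * c * c * (40 * 8) * q
  lower-arithmetic c {n} {N} {l} {L} {D} {F} {q} n≤ L≤ lN≤ ND≤ NF≤ = begin
    n ^ 3 * L                                   ≤⟨ *-mono-≤ (^-monoˡ-≤ 3 n≤) L≤ ⟩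
    (c * (N * N)) ^ 3 * (10 * l)          ≡⟨ step₁ c N l ⟩
    10 * (a * N * (l * N))                ≤⟨ *-monoʳ-≤ 10 (*-monoʳ-≤ (a * N) lN≤) ⟩
    10 * (a * N * (4 * D))                ≡⟨ step₂ a N D ⟩
    40 * (a * (N * D))                      ≤⟨ *-monoʳ-≤ 40 (*-monoʳ-≤ a ND≤) ⟩
    40 * (a * (8 * F))                      ≡⟨ step₃ 40 8 c N F ⟩
    c * c * c * (40 * 8) * (N * N * (N * N) * F) ≤⟨ *-monoʳ-≤ (c * c * c * (40 * 8)) NF≤ ⟩
    c * c * c * (40 * 8) * q                   ∎
    where
    open ≤-Reasoning
    a = c * c * c * (N * N * (N * N))
    step₁ : ∀ c N l → c * (N * N) * (c * (N * N) * (c * (N * N) * 1)) * (10 * l) ≡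
      10 * (c * c * c * (N * N * (N * N)) * N * (l * N))
    step₁ = solve-∀
    step₂ : ∀ a N D → 10 * (a * N * (4 * D)) ≡ 40 * (a * (N * D))
    step₂ = solve-∀
    step₃ : ∀ x y c N F → x * (c * c * c * (N * N * (N * N)) * (y * F)) ≡
      c * c * c * (x * y) * (N * N * (N * N) * F)
    step₃ = solve-∀

  -- The three factors 4 come from the size 4 m, which enters twice, and from 3 + l ≤ 4 l; the 2
  -- comes from `log-upper`.
  upper-arithmetic : ∀ c {n m l D q} → m * m ≤ n → 1 ≤ l → D ≤ (3 + l) * (4 * m) →
    q ≤ m * m * (m * m) * (c * (4 * m * D)) → q * 2 ≤ c * (4 * 4 * 4 * 2) * n ^ 3 * l
  upper-arithmetic c {n} {m} {l} {D} {q} m²≤n 1≤l D≤ q≤ = begin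
    q * 2                                                  ≤⟨ *-monoˡ-≤ 2 q≤ ⟩
    b * (c * (4 * m * D)) * 2
      ≤⟨ *-monoˡ-≤ 2 (*-monoʳ-≤ b (*-monoʳ-≤ c (*-monoʳ-≤ (4 * m) (≤-trans D≤ (*-monoˡ-≤ (4 * m) 3+l≤4l))))) ⟩
    b * (c * (4 * m * (4 * l * (4 * m)))) * 2 ≡⟨ lemma 4 2 c m l ⟩
    c * (4 * 4 * 4 * 2) * (m * m) ^ 3 * l ≤⟨ *-monoˡ-≤ l (*-monoʳ-≤ (c * (4 * 4 * 4 * 2)) (^-monoˡ-≤ 3 m²≤n)) ⟩
    c * (4 * 4 * 4 * 2) * n ^ 3 * l                                ∎
    where
    open ≤-Reasoning
    b = m * m * (m * m)
    3+l≤4l : 3 + l ≤ 4 * l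
    3+l≤4l = ≤-trans (+-monoˡ-≤ l (*-monoʳ-≤ 3 1≤l)) (≤-reflexive (+-comm (3 * l) l))
    lemma : ∀ x y c m l → m * m * (m * m) * (c * (x * m * (x * l * (x * m)))) * y ≡
      c * (x * x * x * y) * (m * m * (m * m * (m * m * 1))) * l
    lemma = solve-∀

  -- The numerals c = 36, e = 6 and A are kept behind variables, since Agda would unfold
  -- products with them into long sums.
  log-∣Q∣-lower : ∀ c e A .{{_ : NonZero A}} → 36 ≤ c → c ≤ 2 ^ e → e ≤ 6 → A ≡ c * c * c * (40 * 8) →
    ∀ {n} → 36 ≤ n → (1ℤ ℚᵘ./ A ℚᵘ.* fromℕ (n ^ 3)) ·log n ≤ fromℕ (∣Q∣ n)
  log-∣Q∣-lower c e A 36≤c c≤2^e e≤6 A≡ {n} 36≤n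
    with N , 2≤N , 9N²≤n , n≤36N² ← floor-third-sqrt 36≤n
    with l , 1≤l , 2^l≤N , N<2^ ← floor-log₂ 2≤N
    = log-lower A (e + (suc l + suc l)) n≤2^ (subst (λ x → n ^ 3 * (e + (suc l + suc l)) ≤ x * ∣Q∣ n) (sym A≡)
        (lower-arithmetic c {N = N} {l} {D = ∑⌊ N / N ⌋} {length (factors N)} n≤cN² exponent≤
          (≤-trans (∑⌊/⌋-lower N l 2^l≤N) (*-monoʳ-≤ 4 (∑-extend (λ i → N / suc i) (≤-trans (m∸n≤m (2 ^ l) 1) 2^l≤N))))
          (many-factors N) (∣Q∣-lower n N 9N²≤n)))
    where
    open ≤-Reasoning
    n≤cN² : n ≤ c * (N * N)
    n≤cN² = ≤-trans n≤36N² (*-monoˡ-≤ (N * N) 36≤c)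
    n≤2^ : n ≤ 2 ^ (e + (suc l + suc l))
    n≤2^ = begin
      n                                       ≤⟨ n≤cN² ⟩
      c * (N * N)                         ≤⟨ *-mono-≤ c≤2^e (*-mono-≤ (<⇒≤ N<2^) (<⇒≤ N<2^)) ⟩
      2 ^ e * (2 ^ suc l * 2 ^ suc l)     ≡⟨ cong (2 ^ e *_) (^-distribˡ-+-* 2 (suc l) (suc l)) ⟨
      2 ^ e * 2 ^ (suc l + suc l)           ≡⟨ ^-distribˡ-+-* 2 e (suc l + suc l) ⟨
      2 ^ (e + (suc l + suc l))               ∎
    -- As l ≥ 1, the constant in 6 + 2 (l + 1) = 8 + 2 l is absorbed into 10 l.
    exponent≤ : e + (suc l + suc l) ≤ 10 * l
    exponent≤ = begin
      e + (suc l + suc l)       ≤⟨ +-monoˡ-≤ (suc l + suc l) e≤6 ⟩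
      6 + (suc l + suc l)       ≡⟨ lemma l ⟩
      8 * 1 + 2 * l         ≤⟨ +-monoˡ-≤ (2 * l) (*-monoʳ-≤ 8 1≤l) ⟩
      8 * l + 2 * l         ≡⟨ *-distribʳ-+ l 8 2 ⟨
      10 * l                  ∎
      where
      lemma : ∀ l → 6 + (suc l + suc l) ≡ 8 * 1 + 2 * l
      lemma = solve-∀

  -- With m = ⌊√n⌋ and l = ⌊log₂ n⌋, the crude estimate 4 m ≤ 4 n < 2^(l+3) lets 3 + l dyadic blocks
  -- cover the sum up to 4 m.
  log-∣Q∣-upper : ∀ c C → 256 ≤ c → C ≡ c * (4 * 4 * 4 * 2) →
    ∀ {n} → 2 ≤ n → fromℕ (∣Q∣ n) ≤ (fromℕ C ℚᵘ.* fromℕ (n ^ 3)) ·log n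
  log-∣Q∣-upper c C 256≤c C≡ {n} 2≤n
    with m , m²≤n , n<[1+m]² ← floor-sqrt n
    with l , 1≤l , 2^l≤n , n<2^ ← floor-log₂ 2≤n
    = log-upper C {n} {n ^ 3} {∣Q∣ n} l 2^l≤n (subst (λ x → ∣Q∣ n * 2 ≤ x * n ^ 3 * l) (sym C≡)
        (upper-arithmetic c {n} {m} {l} {D m} {∣Q∣ n} m²≤n 1≤l
          (≤-trans (∑-extend (λ i → 4 * m / suc i) (∸-monoˡ-≤ 1 4m<2^)) (∑⌊/⌋-upper (4 * m) (3 + l)))
          (≤-trans (∣Q∣-upper n m n<[1+m]²)
            (*-monoʳ-≤ (m * m * (m * m)) (*-monoˡ-≤ (4 * m * D m) 256≤c)))))
    where
    D : ℕ → ℕ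
    D m = ∑⌊ 4 * m / 4 * m ⌋
    m≤m² : ∀ m → m ≤ m * m
    m≤m² zero = z≤n
    m≤m² m@(suc _) = m≤m*n m m
    4m<2^ : 4 * m < 2 ^ (3 + l)
    4m<2^ = subst (4 * m <_) (sym (^-distribˡ-+-* 2 2 (suc l)))
      (*-monoʳ-< 4 (≤-<-trans (≤-trans (m≤m² m) m²≤n) n<2^))

open import Data.Rational.Unnormalised using (_<_; _*_)

mainTheorem1 : ∃[ c ] ∃[ C ] ∃[ n₀ ]
    (0ℚᵘ < c × 0ℚᵘ < C ×
    (∀ (n : ℕ) → .{{_ : NonZero n}} → n₀ ≤ n →
    ((c * fromℕ (n ^ 3)) ·log n ≤ fromℕ (∣Q∣ n)) ×
    (fromℕ (∣Q∣ n) ≤ (C * fromℕ (n ^ 3)) ·log n)))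
-- 14929920 = 36³ · 320 and 32768 = 256 · 128. The exponent 6 satisfies 36 ≤ 2^6 = 36 + 28, and n₀ =
-- 36 is what `floor-third-sqrt` asks for.
mainTheorem1 = 1ℤ ℚᵘ./ 14929920 , fromℕ 32768 , 36 ,
  *<* (ℤ.+<+ (s≤s z≤n)) , *<* (ℤ.+<+ (s≤s z≤n)) ,
  λ n 36≤n → log-∣Q∣-lower 36 6 14929920 ≤-refl (m≤m+n 36 28) ≤-refl refl 36≤n ,
          log-∣Q∣-upper 256 32768 ≤-refl refl (≤-trans (m≤m+n 2 34) 36≤n)
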